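{- Let $q$ be a prime power, and let $C_q\le S_q$ be a cyclic group of order $q$ (acting regularly on $q$ points). Then for all integers $k,d\ge1$, \[ \mathcal L^{C_q^{k-1}}_{\mathsf{AC}}(\textsc{Word}_{C_q,k})\ \ge\ q^{\log_2 k},\qquad \mathcal L^{C_q^{k-1}}_{\mathsf{AC}_d}(\textsc{Word}_{C_q,k})\ \ge\ q^{d(k^{1/d}-1)}. \]
   Context: Word problem. For $G\le S_n$, let $\overline G$ be the set of permutation matrices of elements of $G$, and view $\overline G^k\subseteq\{0,1\}^{kn^2}$ with variables $M_{i,a,b}$ (entry $(a,b)$ of the $i$-th matrix). $\textsc{Word}_{G,k}:\overline G^k\to\{0,1\}$ outputs the $(1,1)$-entry of $M_1\cdots M_k$. The group $G^{k-1}$ acts faithfully on variables by $(g_1,\dots,g_{k-1})\cdot M_{i,a,b}=M_{i,g_{i-1}(a),g_i(b)}$ with $g_0=g_k=1$, i.e. $(M_1,\dots,M_k)\mapsto(M_1\overline{g_1}^{ -1},\overline{g_1}M_2\overline{g_2}^{ -1},\dots,\overline{g_{k-1}}M_k)$. Thus $G^{k-1}\le S_{kn^2}$. Formulas. An $\mathsf{AC}$ formula over $x_1,\dots,x_m$ is a finite rooted tree with unordered children. Leaves are labeled $0,1,x_i,\neg x_i$, and gates are unbounded fan-in $\textsc{and}$ or $\textsc{or}$. Formulas are considered up to labeled-tree isomorphism. Depth is the maximum number of gates on a root-leaf path; size is the number of literal leaves. $S_m$ acts by relabeling literal indices, and $\Phi$ is $P$-invariant ($P\le S_m$) if $\pi\Phi=\Phi$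 for all $\pi\in P$. $\mathcal L^P_{\mathsf{AC}_d}(f)$ (resp. $\mathcal L^P_{\mathsf{AC}}(f)$) is the minimum size of a $P$-invariant $\mathsf{AC}$ formula of depth at most $d$ (resp. any depth) agreeing with $f$ on its domain. -}

module Defs where

open import Data.Bool.Base using (Bool; true; false; not; _∧_; _∨_; if_then_else_)
open import Data.Fin.Base using (Fin; zero; suc; inject₁; fromℕ)
open import Data.Fin.Permutation using (Permutation′; _⟨$⟩ʳ_; _≈_; _∘ₚ_; id; flip)
open import Data.Fin.Properties using () renaming (_≟_ to _≟ᶠ_)
open import Data.Integer.Base using (+_; -[1+_])
open import Data.Nat.Base using (ℕ; zero; suc; _+_; _*_; _^_; _⊔_; _≤_; _<_; _≡ᵇ_; NonZero)
open import Data.Nat.Primality using (Prime)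
open import Data.Nat.Properties using (+-0-monoid)
open import Data.Product.Base using (Σ; _×_; _,_; ∃-syntax)
open import Data.Rational.Unnormalised.Base as ℚᵘ using (ℚᵘ; mkℚᵘ; 1ℚᵘ)
open import Data.Unit.Base using (⊤)
open import Data.Vec.Functional using (foldr)
open import Function.Bundles using (_↔_; Inverse)
open import Level using (0ℓ)
open import Relation.Binary.PropositionalEquality.Core using (_≡_)
open import Relation.Nullary.Decidable.Core using (⌊_⌋)
open import Relation.Nullary.Negation.Core using (¬_)
open import Relation.Unary using (Pred; _∈_)

open import Algebra.Properties.Monoid.Sum +-0-monoid using (sum)

IsPrimePower : ℕ → Set
IsPrimePower q = ∃[ p ] ∃[ m ] Prime p × 1 ≤ m × q ≡ p ^ m

-- A permutation carries inverse-law proofs, so a set of permutations has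
-- to be closed under pointwise equality _≈_.
record IsSubgroup {n : ℕ} (G : Pred (Permutation′ n) 0ℓ) : Set where
  field
    respects-≈ : ∀ {π ρ} → π ≈ ρ → π ∈ G → ρ ∈ G
    id-closed  : id ∈ G
    ∘-closed   : ∀ {π ρ} → π ∈ G → ρ ∈ G → (π ∘ₚ ρ) ∈ G
    inv-closed : ∀ {π} → π ∈ G → flip π ∈ G

_^ₚ_ : ∀ {n} → Permutation′ n → ℕ → Permutation′ n
σ ^ₚ zero  = id
σ ^ₚ suc j = σ ∘ₚ (σ ^ₚ j)

record IsCyclicOfOrder {n : ℕ} (r : ℕ) (G : Pred (Permutation′ n) 0ℓ) : Set where
  field
    generator   : Permutation′ n
    generator∈G : generator ∈ G
    generates   : ∀ {π} → π ∈ G → ∃[ j ] π ≈ (generator ^ₚ j)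
    power-r     : (generator ^ₚ r) ≈ id
    minimal     : ∀ j → 0 < j → j < r → ¬ ((generator ^ₚ j) ≈ id)

record IsRegular {n : ℕ} (G : Pred (Permutation′ n) 0ℓ) : Set where
  field
    transitive : ∀ a b → ∃[ π ] π ∈ G × π ⟨$⟩ʳ a ≡ b
    free       : ∀ {π} a → π ∈ G → π ⟨$⟩ʳ a ≡ a → π ≈ id

data Sign : Set where
  pos neg : Sign

data GateType : Set where
  and or : GateType

-- `gate t n Φ` has fan-in n + 1: a node without children is a leaf.
data Formula (V : Set) : Set where
  const : Bool → Formula V
  lit   : Sign → V → Formula V
  gate  : GateType → (n : ℕ) → (Fin (suc n) → Formula V) → Formula V

module _ {V : Set} where

  -- Labeled-tree isomorphism; π matches up the (unordered) children.
  infix 4 _≅_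
  data _≅_ : Formula V → Formula V → Set where
    const : ∀ b → const b ≅ const b
    lit   : ∀ s v → lit s v ≅ lit s v
    gate  : ∀ t {n} {Φ Ψ : Fin (suc n) → Formula V} (π : Permutation′ (suc n)) →
            (∀ i → Φ i ≅ Ψ (π ⟨$⟩ʳ i)) → gate t n Φ ≅ gate t n Ψ

  depth : Formula V → ℕ
  depth (const _)    = 0
  depth (lit _ _)    = 0
  depth (gate _ _ Φ) = suc (foldr _⊔_ 0 (λ i → depth (Φ i)))

  -- Constant leaves are not counted.
  size : Formula V → ℕ
  size (const _)    = 0
  size (lit _ _)    = 1
  size (gate _ _ Φ) = sum (λ i → size (Φ i))

  eval : Formula V → (V → Bool) → Bool
  eval (const b)      x = b
  eval (lit pos v)    x = x v
  eval (lit neg v)    x = not (x v)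
  eval (gate and _ Φ) x = foldr _∧_ true  (λ i → eval (Φ i) x)
  eval (gate or  _ Φ) x = foldr _∨_ false (λ i → eval (Φ i) x)

  relabel : (V ↔ V) → Formula V → Formula V
  relabel π (const b)    = const b
  relabel π (lit s v)    = lit s (Inverse.to π v)
  relabel π (gate t n Φ) = gate t n (λ i → relabel π (Φ i))

  Invariant : Pred (V ↔ V) 0ℓ → Formula V → Set
  Invariant P Φ = ∀ π → π ∈ P → relabel π Φ ≅ Φ

-- A Boolean function on a subset of {0,1}^V; `value` is meaningful only
-- on `Domain`.
record PartialFunction (V : Set) : Set₁ where
  field
    Domain : Pred (V → Bool) 0ℓ
    value  : (V → Bool) → Bool

Computes : {V : Set} → Formula V → PartialFunction V → Set
Computes Φ f = ∀ x → x ∈ Domain → eval Φ x ≡ value x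
  where open PartialFunction f

-- The formula complexities 𝓛 are minima of the following sets of sizes, with
-- min ∅ = ∞ (at a small depth there may be no suitable formula).
Sizes-AC : {V : Set} → Pred (V ↔ V) 0ℓ → PartialFunction V → Pred ℕ 0ℓ
Sizes-AC P f s = ∃[ Φ ] Invariant P Φ × Computes Φ f × size Φ ≡ s

Sizes-ACd : {V : Set} → ℕ → Pred (V ↔ V) 0ℓ → PartialFunction V → Pred ℕ 0ℓ
Sizes-ACd d P f s =
  ∃[ Φ ] Invariant P Φ × depth Φ ≤ d × Computes Φ f × size Φ ≡ s

Matrix : ℕ → Set
Matrix n = Fin n → Fin n → ℕ

_⊗_ : ∀ {n} → Matrix n → Matrix n → Matrix n
(A ⊗ B) a b = sum (λ c → A a c * B c b)

𝟙 : ∀ {n} → Matrix n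
𝟙 a b = if ⌊ a ≟ᶠ b ⌋ then 1 else 0

-- The convention for which (ḡ M h̄⁻¹)(a , b) = M (g a , h b), as in the action
-- on variables.
permutationMatrix : ∀ {n} → Permutation′ n → Fin n → Fin n → Bool
permutationMatrix g a b = ⌊ g ⟨$⟩ʳ a ≟ᶠ b ⌋

-- (i , a , b) stands for the variable M_{i+1,a+1,b+1}.
Var : ℕ → ℕ → Set
Var k n = Fin k × Fin n × Fin n

first : ∀ {n} .{{_ : NonZero n}} → Fin n
first {suc _} = zero

Word : ∀ {n} .{{_ : NonZero n}} → Pred (Permutation′ n) 0ℓ → (k : ℕ) → PartialFunction (Var k n)
Word {n} G k = record
  { Domain = λ x → Σ (Fin k → Permutation′ n) λ g →
      (∀ i → g i ∈ G) × (∀ i a b → x (i , a , b) ≡ permutationMatrix (g i) a b)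
  ; value  = λ x →
      foldr _⊗_ 𝟙 (λ (i : Fin k) a b → if x (i , a , b) then 1 else 0) first first ≡ᵇ 1
  }

-- The group G^{k-1} as a set of permutations of the variables. Its elements
-- (g₁,…,g_{k-1}) are written as (g₀,…,g_k) with g₀ = g_k = 1; with the index i
-- counted from 0, the i-th matrix lies between g_i and g_{i+1}.
WordGroup : ∀ {n} → Pred (Permutation′ n) 0ℓ → (k : ℕ) → Pred (Var k n ↔ Var k n) 0ℓ
WordGroup {n} G k π = Σ (Fin (suc k) → Permutation′ n) λ g →
  (∀ j → g j ∈ G) × g zero ≈ id × g (fromℕ k) ≈ id ×
  (∀ i a b → Inverse.to π (i , a , b) ≡ (i , g (inject₁ i) ⟨$⟩ʳ a , g (suc i) ⟨$⟩ʳ b))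

-- A real x is represented by the set of rationals r with r ≤ x.
ℝ : Set₁
ℝ = Pred ℚᵘ 0ℓ

-- b ^ℚ r ≼ m means b^r ≤ m, for b ≥ 1: with r = a/e it says b^a ≤ m^e, and
-- with r = -a/e it says 1 ≤ b^a m^e.
_^ℚ_≼_ : ℕ → ℚᵘ → ℕ → Set
b ^ℚ mkℚᵘ (+ a)    e-1 ≼ m = b ^ a ≤ m ^ suc e-1
b ^ℚ mkℚᵘ -[1+ a ] e-1 ≼ m = 1 ≤ b ^ suc a * m ^ suc e-1

-- b^x ≤ m, where b^x = sup { b^r : r rational, r ≤ x }, for b ≥ 1.
_^ℝ_≼_ : ℕ → ℝ → ℕ → Set
b ^ℝ x ≼ m = ∀ r → r ∈ x → b ^ℚ r ≼ m

_^ℝ_≼min_ : ℕ → ℝ → Pred ℕ 0ℓ → Set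
b ^ℝ x ≼min S = ∀ s → s ∈ S → b ^ℝ x ≼ s

log₂ : ℕ → ℝ
log₂ k r = 2 ^ℚ r ≼ k

-- k^{1/d} for d ≥ 1: r = a/e ≥ 0 lies below it iff a^d ≤ k e^d.
root : ℕ → ℕ → ℝ
root d k (mkℚᵘ (+ a)    e-1) = a ^ d ≤ k * suc e-1 ^ d
root d k (mkℚᵘ -[1+ _ ] _)   = ⊤

_-1ℝ : ℝ → ℝ
(x -1ℝ) r = (r ℚᵘ.+ 1ℚᵘ) ∈ x

_·ℝ_ : (d : ℕ) .{{_ : NonZero d}} → ℝ → ℝ
(d ·ℝ x) r = (r ℚᵘ.* (+ 1 ℚᵘ./ d)) ∈ x

{-# OPTIONS --safe #-}

-- Write q = p^(e+1). An input of Word is given by potentials y = (y₀,…,y_k) ∈ C^(k+1),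
-- the i-th matrix being that of y_{i+1}⁻¹ y_i; the group Γ of potentials with
-- y₀ = y_k = 1 acts by translation. Descend from the root of an invariant
-- formula to a leaf, always keeping a vector x such that translation by p^e x changes the
-- value of the current subformula. If U is the stabiliser of a gate and U₁ that of a child,
-- and the socles of U and U₁ differ by n dimensions, a Helly theorem for cosets lets x be
-- replaced by x₁ ∈ x + socle U which, on all sets of fewer than w / (n+1) coordinates,
-- agrees with the socle of U₁, if x did so for U on sets of fewer than w coordinates.
-- At a literal w ≤ 1, so the dimension drops nᵢ satisfy Π (1 + nᵢ) ≥ k, whence
-- 2^(Σ nᵢ) ≥ k, and Σ nᵢ ≥ d (k^(1/d) - 1) by AM-GM. As Γ is free over ℤ/q, a drop of
-- N = Σ nᵢ in the socle forces index q^N, and the leaf has at least that many conjugates.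
module Submission where

open import Defs
open import Algebra.Bundles using (AbelianGroup)
import Algebra.Construct.Pointwise as Pointwise
open import Algebra.Properties.CommutativeMonoid.Sum using (sum-permute)
open import Algebra.Properties.Monoid.Sum using (sum; sum-cong-≗)
open import Data.Bool.Base using (Bool; true; false; not; _∧_; _∨_; if_then_else_)
open import Data.Bool.Properties using () renaming (_≟_ to _≟ᵇ_)
open import Data.Empty using (⊥; ⊥-elim)
open import Data.Fin.Base as Fin using (Fin; zero; suc; toℕ; inject₁; fromℕ; lift; remQuot)
open import Data.Fin.Permutation as Perm using (Permutation′; _⟨$⟩ʳ_; _⟨$⟩ˡ_; _∘ₚ_; flip)
open import Data.Fin.Properties using (any?; combine-remQuot; injective⇒≤; lift-injective; suc-injective)
open import Data.Fin.Properties using (toℕ-injective; toℕ<n) renaming (_≟_ to _≟ᶠ_)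
open import Data.Integer.Base as ℤ using (+_; -[1+_])
import Data.Integer.Properties as ℤ
open import Data.List.Base using (List; []; _∷_; _++_; length)
import Data.List.Membership.DecPropositional as DecMembership
open import Data.List.Membership.Propositional using (_∈_; _∉_)
open import Data.List.Membership.Propositional.Properties using (∈-++⁺ˡ; ∈-++⁺ʳ)
open import Data.List.Membership.Setoid.Properties using (index-injective)
open import Data.List.Properties using (length-++)
open import Data.List.Relation.Unary.Any using (here; index)
open import Data.Nat.Base using (ℕ; zero; suc; _+_; _*_; _^_; _∸_; _⊔_; _≤_; _<_; z≤n; s≤s)
open import Data.Nat.Base using (NonZero; >-nonZero; nonTrivial⇒n>1)
open import Data.Nat.Coprimality using (prime⇒coprime; coprime-Bézout)
open import Data.Nat.GCD using (module Bézout)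
open import Data.Nat.Primality using (Prime; prime⇒nonTrivial; prime⇒nonZero)
open import Data.Nat.Properties hiding (suc-injective)
open import Data.Nat.Tactic.RingSolver using (solve-∀)
open import Data.Product.Base using (_×_; _,_; proj₁; proj₂; ∃-syntax; Σ-syntax)
open import Data.Rational.Unnormalised.Base using (mkℚᵘ)
open import Data.Sum.Base using (inj₁; inj₂)
open import Data.Vec.Functional using (foldr)
open import Function.Base using (_∘_)
open import Function.Bundles using (_↔_; Inverse; mk↔ₛ′)
open import Function.Definitions using (Injective)
open import Level using (0ℓ)
open import Relation.Binary.Definitions using (tri<; tri≈; tri>)
open import Relation.Binary.PropositionalEquality as ≡ using (_≡_; _≢_; _≗_)
open import Relation.Nullary.Decidable using (Dec; yes; no; ⌊_⌋; ¬?; decidable-stable)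
open import Relation.Nullary.Negation.Core using (¬_)
open import Relation.Unary using (Pred; Decidable)

-- Arithmetic

-- `Cost k d c N`: there are n₁, …, n_l with l ≤ d, Σ nᵢ = N and k ≤ c Π (1 + nᵢ).
data Cost (k : ℕ) : ℕ → ℕ → ℕ → Set where
  done : ∀ {d c} → k ≤ c → Cost k d c 0
  step : ∀ {d c N} n → Cost k d (c * suc n) N → Cost k (suc d) c (n + N)

cost-mono : ∀ {k d d′ c N} → d ≤ d′ → Cost k d c N → Cost k d′ c N
cost-mono d≤d′       (done k≤c)    = done k≤c
cost-mono (s≤s d≤d′) (step n cost) = step n (cost-mono d≤d′ cost)

n<p^n : ∀ {p} → 1 < p → ∀ n → n < p ^ n
n<p^n 1<p zero    = s≤s z≤n
n<p^n {p} 1<p (suc n) = begin-strict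
  suc n          ≤⟨ n<p^n 1<p n ⟩
  p ^ n          <⟨ m<m+n (p ^ n) (≤-trans (s≤s z≤n) (n<p^n 1<p n)) ⟩
  p ^ n + p ^ n  ≡⟨ ≡.cong (λ m → p ^ n + m) (+-identityʳ (p ^ n)) ⟨
  2 * p ^ n      ≤⟨ *-monoˡ-≤ (p ^ n) 1<p ⟩
  p * p ^ n      ∎
  where open ≤-Reasoning

-- Every factor satisfies 1 + n ≤ 2^n.
cost-log : ∀ {k d c N} → Cost k d c N → k ≤ c * 2 ^ N
cost-log {c = c} (done k≤c) = ≤-trans k≤c (≤-reflexive (≡.sym (*-identityʳ c)))
cost-log {k} {c = c} (step {N = N} n cost) = begin
  k                    ≤⟨ cost-log cost ⟩
  c * suc n * 2 ^ N    ≡⟨ *-assoc c (suc n) (2 ^ N) ⟩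
  c * (suc n * 2 ^ N)  ≤⟨ *-monoʳ-≤ c (*-monoˡ-≤ (2 ^ N) (n<p^n (s≤s (s≤s z≤n)) n)) ⟩
  c * (2 ^ n * 2 ^ N)  ≡⟨ ≡.cong (c *_) (^-distribˡ-+-* 2 n N) ⟨
  c * 2 ^ (n + N)      ∎
  where open ≤-Reasoning

2xy≤x²+y² : ∀ x y → 2 * (x * y) ≤ x * x + y * y
2xy≤x²+y² x y with ≤-total x y
... | inj₁ x≤y with d , ≡.refl ← m≤n⇒∃[o]m+o≡n x≤y =
  ≤-trans (m≤m+n (2 * (x * (x + d))) (d * d)) (≤-reflexive (identity x d))
  where
  identity : ∀ x d → 2 * (x * (x + d)) + d * d ≡ x * x + (x + d) * (x + d)
  identity = solve-∀
... | inj₂ y≤x with d , ≡.refl ← m≤n⇒∃[o]m+o≡n y≤x =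
  ≤-trans (m≤m+n (2 * ((y + d) * y)) (d * d)) (≤-reflexive (identity y d))
  where
  identity : ∀ y d → 2 * ((y + d) * y) + d * d ≡ (y + d) * (y + d) + y * y
  identity = solve-∀

-- Bernoulli's inequality (x / y)^(n+1) ≥ 1 + (n+1) (x / y - 1), without subtraction or division.
bernoulli : ∀ n x y → suc n * (y ^ n * x) ≤ x ^ suc n + n * y ^ suc n
bernoulli zero    x y = ≤-reflexive (identity x)
  where
  identity : ∀ x → 1 * (1 * x) ≡ x * 1 + 0
  identity = solve-∀
-- Adding n y^(n+1) x to both sides turns the left side into a multiple of 2xy, and the bound x² +
-- y² then leads back to the induction hypothesis.
bernoulli (suc n) x y = +-cancelʳ-≤ (n * (y ^ suc n * x)) _ _ (begin
  suc (suc n) * (y ^ suc n * x) + n * (y ^ suc n * x)        ≡⟨ left n x y (y ^ n) ⟩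
  suc n * y ^ n * (2 * (x * y))                              ≤⟨ *-monoʳ-≤ (suc n * y ^ n) (2xy≤x²+y² x y) ⟩
  suc n * y ^ n * (x * x + y * y)                            ≡⟨ middle n x y (y ^ n) ⟩
  x * (suc n * (y ^ n * x)) + suc n * y ^ suc (suc n)        ≤⟨ +-monoˡ-≤ _ (*-monoʳ-≤ x (bernoulli n x y)) ⟩
  x * (x ^ suc n + n * y ^ suc n) + suc n * y ^ suc (suc n)  ≡⟨ right n x y (x ^ suc n) (y ^ suc n) ⟩
  x ^ suc (suc n) + suc n * y ^ suc (suc n) + n * (y ^ suc n * x)  ∎)
  where
  open ≤-Reasoning
  left : ∀ n x y P → suc (suc n) * (y * P * x) + n * (y * P * x) ≡ suc n * P * (2 * (x * y))
  left = solve-∀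
  middle : ∀ n x y P → suc n * P * (x * x + y * y) ≡ x * (suc n * (P * x)) + suc n * (y * (y * P))
  middle = solve-∀
  right : ∀ n x y Q R → x * (Q + n * R) + suc n * (y * R) ≡ x * Q + suc n * (y * R) + n * (R * x)
  right = solve-∀

^-distrib-* : ∀ x y n → (x * y) ^ n ≡ x ^ n * y ^ n
^-distrib-* x y zero    = ≡.refl
^-distrib-* x y (suc n) = ≡.trans (≡.cong (x * y *_) (^-distrib-* x y n)) (identity x y (x ^ n) (y ^ n))
  where
  identity : ∀ x y P Q → x * y * (P * Q) ≡ x * P * (y * Q)
  identity = solve-∀

-- AM-GM for t and n copies of a / n.
weighted-AM-GM : ∀ n a t → suc n ^ suc n * (t * a ^ n) ≤ n ^ n * (a + t) ^ suc n
weighted-AM-GM zero    a t = begin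
  1 * (t * 1)        ≤⟨ m≤n+m (1 * (t * 1)) a ⟩
  a + 1 * (t * 1)    ≡⟨ identity a t ⟩
  1 * ((a + t) * 1)  ∎
  where
  open ≤-Reasoning
  identity : ∀ a t → a + 1 * (t * 1) ≡ 1 * ((a + t) * 1)
  identity = solve-∀
weighted-AM-GM n@(suc _) a t = *-cancelˡ-≤ n (+-cancelʳ-≤ (n * y ^ suc n) _ _ (begin
  n * (suc n ^ suc n * (t * a ^ n)) + n * y ^ suc n
    ≡⟨ ≡.cong (λ z → n * (suc n ^ suc n * (t * a ^ n)) + n * z) (^-distrib-* (suc n) a (suc n)) ⟩
  n * (suc n ^ suc n * (t * a ^ n)) + n * (suc n ^ suc n * a ^ suc n)
    ≡⟨ expand n a t (suc n ^ n) (a ^ n) ⟩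
  suc n * (suc n ^ n * a ^ n * x)
    ≡⟨ ≡.cong (λ z → suc n * (z * x)) (^-distrib-* (suc n) a n) ⟨
  suc n * (y ^ n * x)
    ≤⟨ bernoulli n x y ⟩
  x ^ suc n + n * y ^ suc n
    ≡⟨ ≡.cong (_+ n * y ^ suc n) (≡.trans (^-distrib-* n (a + t) (suc n)) (*-assoc n (n ^ n) _)) ⟩
  n * (n ^ n * (a + t) ^ suc n) + n * y ^ suc n  ∎))
  where
  open ≤-Reasoning
  x y : ℕ
  -- x / y is the quotient of the two means (a + t) / (n + 1) and a / n.
  x = n * (a + t)
  y = suc n * a
  expand : ∀ n a t P Q → n * (suc n * P * (t * Q)) + n * (suc n * P * (a * Q)) ≡
                         suc n * (P * Q * (n * (a + t)))
  expand = solve-∀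

n^n>0 : ∀ n → NonZero (n ^ n)
n^n>0 zero    = _
n^n>0 (suc n) = m^n≢0 (suc n) (suc n)

-- AM-GM for the factors 1 + nᵢ, padded with ones to d factors, whose sum is d + N.
cost-root : ∀ {k d c N} → Cost k d c N → k * d ^ d ≤ c * (d + N) ^ d
cost-root {k} {d} {c} (done k≤c) =
  ≤-trans (*-monoˡ-≤ (d ^ d) k≤c) (≤-reflexive (≡.cong (λ z → c * z ^ d) (≡.sym (+-identityʳ d))))
cost-root {k} {suc d} {c} (step {N = N} n cost) = *-cancelˡ-≤ (d ^ d) {{n^n>0 d}} (begin
  d ^ d * (k * suc d ^ suc d)                        ≡⟨ swap (d ^ d) k (suc d ^ suc d) ⟩
  suc d ^ suc d * (k * d ^ d)                        ≤⟨ *-monoʳ-≤ (suc d ^ suc d) (cost-root cost) ⟩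
  suc d ^ suc d * (c * suc n * (d + N) ^ d)          ≡⟨ regroup (suc d ^ suc d) c (suc n) ((d + N) ^ d) ⟩
  c * (suc d ^ suc d * (suc n * (d + N) ^ d))        ≤⟨ *-monoʳ-≤ c (weighted-AM-GM d (d + N) (suc n)) ⟩
  c * (d ^ d * (d + N + suc n) ^ suc d)              ≡⟨ ≡.cong (λ z → c * (d ^ d * z ^ suc d)) (total d n N) ⟩
  c * (d ^ d * (suc d + (n + N)) ^ suc d)            ≡⟨ exchange c (d ^ d) _ ⟩
  d ^ d * (c * (suc d + (n + N)) ^ suc d)            ∎)
  where
  open ≤-Reasoning
  swap : ∀ P k Q → P * (k * Q) ≡ Q * (k * P)
  swap = solve-∀
  regroup : ∀ P c t Q → P * (c * t * Q) ≡ c * (P * (t * Q))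
  regroup = solve-∀
  total : ∀ d n N → d + N + suc n ≡ suc d + (n + N)
  total = solve-∀
  exchange : ∀ c P Q → c * (P * Q) ≡ P * (c * Q)
  exchange = solve-∀

-- Accounting for the descent in Helly's theorem: a round adds l coordinates to the t already
-- collected, and l c < k lets it be paid from the k units reserved for it.
budget-step : ∀ t l c k m {b} → l * c < k → t * c + suc m * k ≤ b → (t + l) * c + m * k < b
budget-step t l c k m {b} lc<k fits = begin-strict
  (t + l) * c + m * k      ≡⟨ ≡.cong (_+ m * k) (*-distribʳ-+ c t l) ⟩
  t * c + l * c + m * k    ≡⟨ +-assoc (t * c) (l * c) (m * k) ⟩
  t * c + (l * c + m * k)  <⟨ +-monoʳ-< (t * c) (+-monoˡ-< (m * k) lc<k) ⟩
  t * c + suc m * k        ≤⟨ fits ⟩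
  b                        ∎
  where open ≤-Reasoning

-- A union collected within the budget n k, at the price c n per coordinate, is still below the
-- threshold k / c.
budget⇒small : ∀ l c n k m → l * (c * n) + m < n * k → l * c < k
budget⇒small l c n k m fits = *-cancelˡ-< n (l * c) k (begin-strict
  n * (l * c)      ≡⟨ *-comm n (l * c) ⟩
  l * c * n        ≡⟨ *-assoc l c n ⟩
  l * (c * n)      ≤⟨ m≤m+n (l * (c * n)) m ⟩
  l * (c * n) + m  <⟨ fits ⟩
  n * k            ∎)
  where open ≤-Reasoning

-- Subgroups and indices

module Subgroups (𝔸 : AbelianGroup 0ℓ 0ℓ) where

  open AbelianGroup 𝔸 renaming (Carrier to A) public
  open import Algebra.Properties.AbelianGroup 𝔸
  open import Algebra.Properties.CommutativeSemigroup commutativeSemigroup using (interchange)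
  open import Algebra.Properties.CommutativeMonoid.Mult commutativeMonoid
    renaming (_×_ to _·_; ×-congʳ to ·-congʳ; ×-congˡ to ·-congˡ; ×-homo-1 to ·-homo-1;
              ×-homo-+ to ·-homo-+; ×-assocˡ to ·-assocˡ; ×-distrib-+ to ·-distrib-∙) public
  open import Relation.Binary.Reasoning.Setoid setoid

  ∙-medial : ∀ a b c d → (a ∙ b) - (c ∙ d) ≈ (a - c) ∙ (b - d)
  ∙-medial a b c d = trans (∙-congˡ (sym (⁻¹-∙-comm c d))) (interchange a b (c ⁻¹) (d ⁻¹))

  -‿telescope : ∀ x y z → (x - y) ∙ (y - z) ≈ x - z
  -‿telescope x y z = begin
    (x - y) ∙ (y ∙ z ⁻¹)  ≈⟨ assoc (x - y) y (z ⁻¹) ⟨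
    ((x - y) ∙ y) ∙ z ⁻¹  ≈⟨ ∙-congʳ (//-rightDividesˡ y x) ⟩
    x - z                 ∎

  -‿cancelʳ : ∀ x y z → (x - z) - (y - z) ≈ x - y
  -‿cancelʳ x y z = trans (∙-congˡ (⁻¹-anti-homo‿- y z)) (-‿telescope x z y)

  ·-homo-⁻¹ : ∀ n x → n · (x ⁻¹) ≈ (n · x) ⁻¹
  ·-homo-⁻¹ zero    x = sym ε⁻¹≈ε
  ·-homo-⁻¹ (suc n) x = trans (∙-congˡ (·-homo-⁻¹ n x)) (⁻¹-∙-comm x (n · x))

  ·-distrib-- : ∀ n x y → n · (x - y) ≈ n · x - n · y
  ·-distrib-- n x y = trans (·-distrib-∙ x (y ⁻¹) n) (∙-congˡ (·-homo-⁻¹ n y))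

  ·-split : ∀ n x y → n · (x - y) ∙ n · y ≈ n · x
  ·-split n x y = trans (sym (·-distrib-∙ (x - y) y n)) (·-congʳ n (//-rightDividesˡ y x))

  x-[x-y]≈y : ∀ x y → x - (x - y) ≈ y
  x-[x-y]≈y x y = trans (∙-congˡ (⁻¹-anti-homo‿- x y)) (trans (comm x (y - x)) (//-rightDividesˡ x y))

  record Subgroup : Set₁ where
    infix 4 _∋_
    field
      _∋_ : Pred A 0ℓ
      resp : ∀ {x y} → x ≈ y → _∋_ x → _∋_ y
      ε∈   : _∋_ ε
      ∙∈   : ∀ {x y} → _∋_ x → _∋_ y → _∋_ (x ∙ y)
      ⁻¹∈  : ∀ {x} → _∋_ x → _∋_ (x ⁻¹)

    -∈ : ∀ {x y} → _∋_ x → _∋_ y → _∋_ (x - y)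
    -∈ x∈ y∈ = ∙∈ x∈ (⁻¹∈ y∈)

    ·∈ : ∀ n {x} → _∋_ x → _∋_ (n · x)
    ·∈ zero    x∈ = ε∈
    ·∈ (suc n) x∈ = ∙∈ x∈ (·∈ n x∈)

    ∙-factorˡ : ∀ {x y} → _∋_ (x ∙ y) → _∋_ y → _∋_ x
    ∙-factorˡ {x} {y} xy∈ y∈ = resp (//-rightDividesʳ y x) (-∈ xy∈ y∈)

    ∙-factorʳ : ∀ {x y} → _∋_ (x ∙ y) → _∋_ x → _∋_ y
    ∙-factorʳ {x} {y} xy∈ x∈ = ∙-factorˡ (resp (comm x y) xy∈) x∈

  open Subgroup public

  infix 4 _⊑_
  _⊑_ : Subgroup → Subgroup → Set
  U ⊑ W = ∀ {x} → U ∋ x → W ∋ x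

  _⊓_ : Subgroup → Subgroup → Subgroup
  U ⊓ W = record
    { _∋_  = λ x → U ∋ x × W ∋ x
    ; resp = λ eq (a , b) → resp U eq a , resp W eq b
    ; ε∈   = ε∈ U , ε∈ W
    ; ∙∈   = λ (a , b) (c , d) → ∙∈ U a c , ∙∈ W b d
    ; ⁻¹∈  = λ (a , b) → ⁻¹∈ U a , ⁻¹∈ W b
    }

  _⊞_ : Subgroup → Subgroup → Subgroup
  U ⊞ W = record
    { _∋_  = λ x → ∃[ u ] U ∋ u × W ∋ x - u
    ; resp = λ eq (u , a , b) → u , a , resp W (∙-congʳ eq) b
    ; ε∈   = ε , ε∈ U , resp W (sym (inverseʳ ε)) (ε∈ W)
    ; ∙∈   = λ {x} {y} (u , a , b) (v , c , d) →
               u ∙ v , ∙∈ U a c , resp W (sym (∙-medial x y u v)) (∙∈ W b d)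
    ; ⁻¹∈  = λ {x} (u , a , b) →
               u ⁻¹ , ⁻¹∈ U a , resp W (sym (⁻¹-∙-comm x (u ⁻¹))) (⁻¹∈ W b)
    }

  Preimage : ℕ → Subgroup → Subgroup
  Preimage n U = record
    { _∋_  = λ x → U ∋ n · x
    ; resp = λ eq → resp U (·-congʳ n eq)
    ; ε∈   = ·∈ U n (ε∈ U)
    ; ∙∈   = λ {x} {y} a b → resp U (sym (·-distrib-∙ x y n)) (∙∈ U a b)
    ; ⁻¹∈  = λ {x} a → resp U (sym (·-homo-⁻¹ n x)) (⁻¹∈ U a)
    }

  -- `Separated U D n` says [U : D] ≥ n.
  record Separated (U D : Subgroup) (n : ℕ) : Set where
    constructor separated
    field
      family    : Fin n → A
      family∈   : ∀ i → U ∋ family i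
      separates : ∀ i j → D ∋ family i - family j → i ≡ j

  separated-mono : ∀ {U U′ D D′ n} → U ⊑ U′ → D′ ⊑ D → Separated U D n → Separated U′ D′ n
  separated-mono U⊑U′ D′⊑D (separated f f∈ sep) =
    separated f (λ i → U⊑U′ (f∈ i)) (λ i j d → sep i j (D′⊑D d))

  -- Products of representatives: the first factor is determined modulo W, and once it cancels, the
  -- second is determined modulo D.
  separated-* : ∀ {U W D m n} → W ⊑ U → D ⊑ W →
                Separated U W m → Separated W D n → Separated U D (m * n)
  separated-* {U} {W} {D} {m} {n} W⊑U D⊑W (separated f f∈ f-sep) (separated g g∈ g-sep) =
    separated (λ i → f (quo i) ∙ g (rem i)) (λ i → ∙∈ U (f∈ (quo i)) (W⊑U (g∈ (rem i)))) sep
    where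
    quo : Fin (m * n) → Fin m
    quo i = proj₁ (remQuot {m} n i)
    rem : Fin (m * n) → Fin n
    rem i = proj₂ (remQuot {m} n i)

    sep : ∀ i j → D ∋ (f (quo i) ∙ g (rem i)) - (f (quo j) ∙ g (rem j)) → i ≡ j
    sep i j d = ≡.trans (≡.sym (combine-remQuot {m} n i))
               (≡.trans (≡.cong₂ Fin.combine quo≡ rem≡) (combine-remQuot {m} n j))
      where
      d′ : D ∋ (f (quo i) - f (quo j)) ∙ (g (rem i) - g (rem j))
      d′ = resp D (∙-medial _ _ _ _) d
      quo≡ : quo i ≡ quo j
      quo≡ = f-sep _ _ (∙-factorˡ W (D⊑W d′) (-∈ W (g∈ (rem i)) (g∈ (rem j))))
      rem≡ : rem i ≡ rem j
      rem≡ = g-sep _ _ (∙-factorʳ D d′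
        (resp D (sym (x≈y⇒x∙y⁻¹≈ε (reflexive (≡.cong f quo≡)))) (ε∈ D)))

  separated-1 : ∀ {U D} → Separated U D 1
  separated-1 {U} = separated (λ _ → ε) (λ _ → ε∈ U) λ { zero zero _ → ≡.refl }

  -- Bézout's identity for p and d writes h as a difference of multiples of p · h and d · h.
  coprime-torsion : ∀ {p d} (U : Subgroup) → Prime p → 0 < d → d < p →
                    ∀ {h} → U ∋ p · h → U ∋ d · h → U ∋ h
  coprime-torsion {p} {d} U p-prime 0<d d<p {h} ph∈ dh∈
    with coprime-Bézout (prime⇒coprime p-prime {{>-nonZero 0<d}} d<p)
  ... | Bézout.+- x y eq = ∙-factorˡ U
          (resp U (trans (·-assocˡ h x p) (·-congˡ (≡.sym eq))) (·∈ U x ph∈))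
          (resp U (·-assocˡ h y d) (·∈ U y dh∈))
  ... | Bézout.-+ x y eq = ∙-factorˡ U
          (resp U (trans (·-assocˡ h y d) (·-congˡ (≡.sym eq))) (·∈ U y dh∈))
          (resp U (·-assocˡ h x p) (·∈ U x ph∈))

  -- As h has order p modulo W, its multiples by 0, ..., p - 1 represent distinct cosets.
  separated-p : ∀ {p} {U W : Subgroup} → Prime p →
                ∀ {h} → U ∋ h → ¬ (W ∋ h) → W ∋ p · h → Separated U W p
  separated-p {p} {U} {W} p-prime {h} h∈ h∉ ph∈ =
    separated (λ i → toℕ i · h) (λ i → ·∈ U (toℕ i) h∈) sep
    where
    multiple : ∀ {a b} → b < a → a · h ≈ (a ∸ b) · h ∙ b · h
    multiple {a} {b} b<a = trans (·-congˡ (≡.sym (m∸n+n≡m (<⇒≤ b<a)))) (·-homo-+ h (a ∸ b) b)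

    gap : ∀ {a b} → b < a → a < p → ¬ (W ∋ a · h - b · h)
    gap {a} {b} b<a a<p d = h∉ (coprime-torsion W p-prime (m<n⇒0<n∸m b<a)
      (≤-<-trans (m∸n≤m a b) a<p) ph∈
      (resp W (trans (∙-congʳ (multiple b<a)) (//-rightDividesʳ (b · h) _)) d))

    sep : ∀ i j → W ∋ toℕ i · h - toℕ j · h → i ≡ j
    sep i j d with <-cmp (toℕ i) (toℕ j)
    ... | tri< i<j _ _ =
            ⊥-elim (gap i<j (toℕ<n j) (resp W (⁻¹-anti-homo‿- _ _) (⁻¹∈ W d)))
    ... | tri≈ _ i≡j _ = toℕ-injective i≡j
    ... | tri> _ _ j<i = ⊥-elim (gap j<i (toℕ<n i) d)

  -- If p U lies in D, a chain of length n says that U / D has dimension at least n over the field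
  -- of p elements. Each strict inclusion carries a witness, from which coset representatives are
  -- built.
  data Chain : Subgroup → Subgroup → ℕ → Set₁ where
    done : ∀ {U D} → D ⊑ U → Chain U D 0
    step : ∀ {U D n} W → W ⊑ U → ∀ h → U ∋ h → ¬ (W ∋ h) → Chain W D n → Chain U D (suc n)

  chain-⊑ : ∀ {U D n} → Chain U D n → D ⊑ U
  chain-⊑ (done D⊑U)              = D⊑U
  chain-⊑ (step _ W⊑U _ _ _ rest) = λ x∈ → W⊑U (chain-⊑ rest x∈)

  chain-weaken : ∀ {U U′ D n} → U ⊑ U′ → Chain U D n → Chain U′ D n
  chain-weaken U⊑U′ (done D⊑U)                 = done (λ x∈ → U⊑U′ (D⊑U x∈))
  chain-weaken U⊑U′ (step W W⊑U h h∈ h∉ rest) = step W (λ x∈ → U⊑U′ (W⊑U x∈)) h (U⊑U′ h∈) h∉ rest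

  chain-++ : ∀ {U W D m n} → Chain U W m → Chain W D n → Chain U D (m + n)
  chain-++ (done W⊑U)                rest = chain-weaken W⊑U rest
  chain-++ (step W W⊑U h h∈ h∉ c) rest = step W W⊑U h h∈ h∉ (chain-++ c rest)

  chain⇒separated : ∀ {p U D n} → Prime p → (∀ {x} → U ∋ x → D ∋ p · x) →
                    Chain U D n → Separated U D (p ^ n)
  chain⇒separated p-prime tors (done D⊑U) = separated-1
  chain⇒separated {U = U} {D} p-prime tors (step W W⊑U h h∈ h∉ c) =
    separated-* {W = W} {D} W⊑U (chain-⊑ c)
      (separated-p p-prime h∈ h∉ (chain-⊑ c (tors h∈)))
      (chain⇒separated p-prime (λ x∈ → tors (W⊑U x∈)) c)

  -- A bound on the index at the socle is amplified to every layer p^i Γ / p^(i+1) Γ.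
  separated-layers : ∀ {p K} (Γ : Subgroup) e (D : Subgroup) → D ⊑ Γ →
                     (∀ {x} → Γ ∋ x → D ∋ (p ^ suc e) · x) →
                     Separated Γ (Γ ⊓ Preimage (p ^ e) D) K → Separated Γ D (K ^ suc e)
  separated-layers {p} {K} Γ zero D D⊑Γ tors sep =
    ≡.subst (Separated Γ D) (≡.sym (*-identityʳ K))
      (separated-mono (λ x∈ → x∈) (λ x∈ → D⊑Γ x∈ , resp D (sym (·-homo-1 _)) x∈) sep)
  separated-layers {p} {K} Γ (suc e) D D⊑Γ tors sep@(separated f f∈ f-sep) =
    ≡.subst (Separated Γ D) (*-comm (K ^ suc e) K)
      -- Induction bounds [Γ : D′], because the pullback of D′ along p^e is that of D along p^(e+1).
      (separated-* {W = D′} {D} proj₁ (λ x∈ → D⊑Γ x∈ , ·∈ D p x∈)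
        (separated-layers Γ e D′ proj₁
          (λ {x} x∈ → ·∈ Γ (p ^ suc e) x∈ ,
            resp D (sym (·-assocˡ x p (p ^ suc e))) (tors x∈))
          (separated-mono (λ x∈ → x∈)
            (λ {x} (x∈ , _ , y∈) → x∈ , resp D (·-assocˡ x p (p ^ e)) y∈) sep))
        -- These multiples show [D′ : D] ≥ K: they lie in D′ by torsion and differ modulo D as the f
        -- i differ modulo the pullback of D.
        (separated
          (λ i → (p ^ suc e) · f i)
          (λ i → ·∈ Γ (p ^ suc e) (f∈ i) , resp D (sym (·-assocˡ (f i) p (p ^ suc e))) (tors (f∈ i)))
          (λ i j d → f-sep i j (-∈ Γ (f∈ i) (f∈ j) ,
            resp D (sym (·-distrib-- (p ^ suc e) (f i) (f j))) d))))
    where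
    D′ : Subgroup
    D′ = Γ ⊓ Preimage p D

  module Helly {k : ℕ} (Z : Fin k → Subgroup) where

    Z[_] : List (Fin k) → Subgroup
    Z[ Q ] = record
      { _∋_  = λ x → ∀ {i} → i ∈ Q → Z i ∋ x
      ; resp = λ eq a {i} i∈ → resp (Z i) eq (a i∈)
      ; ε∈   = λ {i} _ → ε∈ (Z i)
      ; ∙∈   = λ a b {i} i∈ → ∙∈ (Z i) (a i∈) (b i∈)
      ; ⁻¹∈  = λ a {i} i∈ → ⁻¹∈ (Z i) (a i∈)
      }

    -- On every set of fewer than k / c coordinates, x agrees with an element of S. The double
    -- negation allows a failure to be turned into a set Q where it occurs.
    LocallyIn : ℕ → Subgroup → A → Set
    LocallyIn c S x = ∀ Q → length Q * c < k → ¬ ¬ ((S ⊞ Z[ Q ]) ∋ x)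

    Found : ℕ → Subgroup → Subgroup → A → Set
    Found c S S₁ x = ∃[ x₁ ] S ∋ x₁ - x × LocallyIn c S₁ x₁

    -- Helly's theorem for cosets: the cosets to be hit, one for each small Q, any
    -- n + 1 of which meet, have a common point unless S / S₁ has a chain of length n + 1.
    module _ (S S₁ : Subgroup) (S₁⊑S : S₁ ⊑ S) (c : ℕ) (x : A) (local : LocallyIn c S x) (n : ℕ) where

      -- T collects the sets on which earlier candidates failed, and all points of x + S in `Z[ T ]`
      -- lie in x₀ + H. If a small Q refutes the candidate x₀, then H shrinks strictly to H ⊓ (S₁ ⊞
      -- Z[ Q ]). The budget reserves k units for each of the m remaining rounds.
      descend : ∀ m T → length T * (c * suc n) + m * k ≤ suc n * k →
                ∀ H → S₁ ⊑ H → ∀ x₀ → S ∋ x₀ - x →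
                (∀ {y} → S ∋ y - x → Z[ T ] ∋ y → H ∋ y - x₀) →
                ¬ Found (c * suc n) S S₁ x → ¬ ¬ Chain H S₁ m
      descend zero    T _    H S₁⊑H x₀ x₀∈ inv ¬found ¬chain = ¬chain (done S₁⊑H)
      descend (suc m) T fits H S₁⊑H x₀ x₀∈ inv ¬found ¬chain =
        -- The local hypothesis on T ++ Q yields the point x - s of x + S, which becomes the next
        -- candidate.
        ¬found (x₀ , x₀∈ , λ Q small x₀∉ → local (T ++ Q) (fits′ Q small) λ (s , s∈ , x-s∈) →
          extend Q small x₀∉ (x - s)
            (resp S (sym (xyx⁻¹≈y x (s ⁻¹))) (⁻¹∈ S s∈)) x-s∈)
        where
        grow : ∀ Q → length Q * (c * suc n) < k →
               length (T ++ Q) * (c * suc n) + m * k < suc n * k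
        grow Q small = ≡.subst (λ l → l * (c * suc n) + m * k < suc n * k) (≡.sym (length-++ T))
          (budget-step (length T) (length Q) (c * suc n) k m small fits)

        fits′ : ∀ Q → length Q * (c * suc n) < k → length (T ++ Q) * c < k
        fits′ Q small = budget⇒small (length (T ++ Q)) c (suc n) k (m * k) (grow Q small)

        extend : ∀ Q → length Q * (c * suc n) < k → ¬ ((S₁ ⊞ Z[ Q ]) ∋ x₀) →
                 ∀ x₁ → S ∋ x₁ - x → Z[ T ++ Q ] ∋ x₁ → ⊥
        extend Q small x₀∉ x₁ x₁∈ vanishes =
          descend m (T ++ Q) (<⇒≤ (grow Q small)) H′
            (λ {s} s∈ → S₁⊑H s∈ , s , s∈ , λ {i} _ → resp (Z i) (sym (inverseʳ s)) (ε∈ (Z i)))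
            x₁ x₁∈
            (λ {y} y∈ y-vanishes →
              resp H (-‿cancelʳ y x₁ x₀) (-∈ H (inv y∈ (λ i∈ → y-vanishes (∈-++⁺ˡ i∈))) x₁-x₀∈) ,
              ε , ε∈ S₁ , λ {i} i∈ → resp (Z i) (sym (trans (∙-congˡ ε⁻¹≈ε) (identityʳ _)))
                (-∈ (Z i) (y-vanishes (∈-++⁺ʳ T i∈)) (vanishes (∈-++⁺ʳ T i∈))))
            ¬found
            -- The witness of strictness is x₁ - x₀: since x₁ lies in `Z[ Q ]`, membership of the
            -- difference in S₁ ⊞ Z[ Q ] would put x₀ there too.
            (λ chain → ¬chain (step H′ proj₁ (x₁ - x₀) x₁-x₀∈ (λ (_ , d) → x₀∉ (hit d)) chain))
          where
          H′ : Subgroup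
          H′ = H ⊓ (S₁ ⊞ Z[ Q ])

          x₁-x₀∈ : H ∋ x₁ - x₀
          x₁-x₀∈ = inv x₁∈ (λ i∈ → vanishes (∈-++⁺ˡ i∈))

          hit : (S₁ ⊞ Z[ Q ]) ∋ x₁ - x₀ → (S₁ ⊞ Z[ Q ]) ∋ x₀
          hit d = resp (S₁ ⊞ Z[ Q ]) (⁻¹-involutive x₀)
            (⁻¹∈ (S₁ ⊞ Z[ Q ]) (∙-factorʳ (S₁ ⊞ Z[ Q ]) d
              (ε , ε∈ S₁ , λ {i} i∈ → resp (Z i) (sym (trans (∙-congˡ ε⁻¹≈ε) (identityʳ _)))
                (vanishes (∈-++⁺ʳ T i∈)))))

      helly : ¬ Found (c * suc n) S S₁ x → ¬ ¬ Chain S S₁ (suc n)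
      helly = descend (suc n) [] ≤-refl S S₁⊑S x
        (resp S (sym (inverseʳ x)) (ε∈ S)) (λ y∈ _ → y∈)

-- Counting

record Split {n : ℕ} (P : Pred (Fin n) 0ℓ) : Set where
  field
    {m m′}      : ℕ
    m+m′≡n      : m + m′ ≡ n
    inn         : Fin m → Fin n
    inn-inj     : Injective _≡_ _≡_ inn
    inn-P       : ∀ a → P (inn a)
    out         : Fin m′ → Fin n
    out-inj     : Injective _≡_ _≡_ out
    out-¬P      : ∀ a → ¬ P (out a)

split : ∀ {n} {P : Pred (Fin n) 0ℓ} → Decidable P → Split P
split {zero} P? = record
  { m = 0 ; m′ = 0 ; m+m′≡n = ≡.refl
  ; inn = λ () ; inn-inj = λ { {()} } ; inn-P = λ ()
  ; out = λ () ; out-inj = λ { {()} } ; out-¬P = λ () }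
split {suc n} {P} P? with P? zero | split {n} {P ∘ suc} (P? ∘ suc)
... | yes P0 | s = record
  { m+m′≡n = ≡.cong suc m+m′≡n
  ; inn = lift 1 inn ; inn-inj = lift-injective inn inn-inj 1 ; inn-P = λ { zero → P0 ; (suc a) → inn-P a }
  ; out = suc ∘ out ; out-inj = out-inj ∘ suc-injective ; out-¬P = out-¬P }
  where open Split s
... | no ¬P0 | s = record
  { m+m′≡n = ≡.trans (+-suc _ _) (≡.cong suc m+m′≡n)
  ; inn = suc ∘ inn ; inn-inj = inn-inj ∘ suc-injective ; inn-P = inn-P
  ; out = lift 1 out ; out-inj = lift-injective out out-inj 1
  ; out-¬P = λ { zero → ¬P0 ; (suc a) → out-¬P a } }
  where open Split s

-- Splitting off the fibre over `zero` leaves a map into a set with one element fewer. Fibre sizes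
-- are measured by injections into the fibres.
fibres-bound : ∀ {m l} (τ : Fin m → Fin l) (s : Fin l → ℕ) →
  (∀ j {m′} (g : Fin m′ → Fin m) → Injective _≡_ _≡_ g → (∀ a → τ (g a) ≡ j) → m′ ≤ s j) →
  m ≤ sum +-0-monoid s
fibres-bound {zero}  {zero}  τ s small = z≤n
fibres-bound {suc m} {zero}  τ s small with () ← τ zero
fibres-bound {m}     {suc l} τ s small = ≤-trans (≤-reflexive (≡.sym m+m′≡n)) (+-mono-≤
  (small zero inn inn-inj inn-P)
  (fibres-bound τ′ (s ∘ suc) λ j g g-inj g-fib → small (suc j) (out ∘ g) (g-inj ∘ out-inj)
    λ a → ≡.trans (≡.sym (suc-τ′ (g a))) (≡.cong suc (g-fib a))))
  where
  open Split (split (λ a → τ a ≟ᶠ zero)) hiding (m)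
  pred : (j : Fin (suc l)) → j ≢ zero → Σ[ j′ ∈ Fin l ] suc j′ ≡ j
  pred zero    j≢0 = ⊥-elim (j≢0 ≡.refl)
  pred (suc j) j≢0 = j , ≡.refl
  τ′ : Fin m′ → Fin l
  τ′ a = proj₁ (pred (τ (out a)) (out-¬P a))
  suc-τ′ : ∀ a → suc (τ′ a) ≡ τ (out a)
  suc-τ′ a = proj₂ (pred (τ (out a)) (out-¬P a))

-- Formulas

absorbing : GateType → Bool
absorbing and = false
absorbing or  = true

-- Used with the absorbing value of a gate, which always has a child as witness, so that `and` and
-- `or` share one argument.
Bool-ext : ∀ a {b c : Bool} → (b ≡ a → c ≡ a) → (c ≡ a → b ≡ a) → b ≡ c
Bool-ext a     {true}  {true}  f g = ≡.refl
Bool-ext a     {false} {false} f g = ≡.refl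
Bool-ext true  {true}  {false} f g = ≡.sym (f ≡.refl)
Bool-ext true  {false} {true}  f g = g ≡.refl
Bool-ext false {true}  {false} f g = g ≡.refl
Bool-ext false {false} {true}  f g = ≡.sym (f ≡.refl)

module _ {V : Set} where

  ≅-refl : (Φ : Formula V) → Φ ≅ Φ
  ≅-refl (const b)    = const b
  ≅-refl (lit s v)    = lit s v
  ≅-refl (gate t n Φ) = gate t Perm.id (λ i → ≅-refl (Φ i))

  ≅-sym : {Φ Ψ : Formula V} → Φ ≅ Ψ → Ψ ≅ Φ
  ≅-sym (const b) = const b
  ≅-sym (lit s v) = lit s v
  ≅-sym (gate t {Φ = Φ} {Ψ} π eqs) = gate t (flip π) λ j →
    ≡.subst (λ j′ → Ψ j′ ≅ Φ (π ⟨$⟩ˡ j)) (Perm.inverseʳ π) (≅-sym (eqs (π ⟨$⟩ˡ j)))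

  ≅-trans : {Φ Ψ Θ : Formula V} → Φ ≅ Ψ → Ψ ≅ Θ → Φ ≅ Θ
  ≅-trans (const b)       (const .b)      = const b
  ≅-trans (lit s v)       (lit .s .v)     = lit s v
  ≅-trans (gate t π eqs)  (gate .t ρ eqs′) = gate t (π ∘ₚ ρ) λ i → ≅-trans (eqs i) (eqs′ (π ⟨$⟩ʳ i))

  relabel-≅ : ∀ (π : V ↔ V) {Φ Ψ} → Φ ≅ Ψ → relabel π Φ ≅ relabel π Ψ
  relabel-≅ π (const b)      = const b
  relabel-≅ π (lit s v)      = lit s _
  relabel-≅ π (gate t ρ eqs) = gate t ρ λ i → relabel-≅ π (eqs i)

  relabel-id : ∀ (π : V ↔ V) → (∀ v → Inverse.to π v ≡ v) → ∀ Φ → relabel π Φ ≅ Φ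
  relabel-id π fix (const b)    = const b
  relabel-id π fix (lit s v)    rewrite fix v = lit s v
  relabel-id π fix (gate t n Φ) = gate t Perm.id λ i → relabel-id π fix (Φ i)

  relabel-∘ : ∀ (π ρ τ : V ↔ V) → (∀ v → Inverse.to π (Inverse.to ρ v) ≡ Inverse.to τ v) →
              ∀ Φ → relabel π (relabel ρ Φ) ≅ relabel τ Φ
  relabel-∘ π ρ τ eq (const b)    = const b
  relabel-∘ π ρ τ eq (lit s v)    rewrite eq v = lit s _
  relabel-∘ π ρ τ eq (gate t n Φ) = gate t Perm.id λ i → relabel-∘ π ρ τ eq (Φ i)

  relabel-cong : ∀ (π ρ : V ↔ V) → (∀ v → Inverse.to π v ≡ Inverse.to ρ v) →
                 ∀ Φ → relabel π Φ ≅ relabel ρ Φ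
  relabel-cong π ρ eq (const b)    = const b
  relabel-cong π ρ eq (lit s v)    rewrite eq v = lit s _
  relabel-cong π ρ eq (gate t n Φ) = gate t Perm.id λ i → relabel-cong π ρ eq (Φ i)

  size-relabel : ∀ (π : V ↔ V) Φ → size (relabel π Φ) ≡ size Φ
  size-relabel π (const b)    = ≡.refl
  size-relabel π (lit s v)    = ≡.refl
  size-relabel π (gate t n Φ) = sum-cong-≗ +-0-monoid (λ i → size-relabel π (Φ i))

  size-≅ : {Φ Ψ : Formula V} → Φ ≅ Ψ → size Φ ≡ size Ψ
  size-≅ (const b) = ≡.refl
  size-≅ (lit s v) = ≡.refl
  size-≅ (gate t {Φ = Φ} {Ψ} π eqs) = ≡.trans
    (sum-cong-≗ +-0-monoid (λ i → size-≅ (eqs i)))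
    (≡.sym (sum-permute +-0-commutativeMonoid (λ i → size (Ψ i)) π))

  depth-child : ∀ t n (Φ : Fin (suc n) → Formula V) i → suc (depth (Φ i)) ≤ depth (gate t n Φ)
  depth-child t n Φ i = s≤s (≤-max (λ i → depth (Φ i)) i)
    where
    ≤-max : ∀ {n} (f : Fin n → ℕ) i → f i ≤ foldr _⊔_ 0 f
    ≤-max f zero    = m≤m⊔n _ _
    ≤-max f (suc i) = ≤-trans (≤-max (f ∘ suc) i) (m≤n⊔m _ _)

  eval-gate⁺ : ∀ t n (Φ : Fin (suc n) → Formula V) x i →
               eval (Φ i) x ≡ absorbing t → eval (gate t n Φ) x ≡ absorbing t
  eval-gate⁺ and n Φ x i = go (λ i → eval (Φ i) x) i
    where
    go : ∀ {n} (f : Fin n → Bool) i → f i ≡ false → foldr _∧_ true f ≡ false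
    go f zero    eq rewrite eq = ≡.refl
    go f (suc i) eq with f zero
    ... | false = ≡.refl
    ... | true  = go (f ∘ suc) i eq
  eval-gate⁺ or n Φ x i = go (λ i → eval (Φ i) x) i
    where
    go : ∀ {n} (f : Fin n → Bool) i → f i ≡ true → foldr _∨_ false f ≡ true
    go f zero    eq rewrite eq = ≡.refl
    go f (suc i) eq with f zero
    ... | true  = ≡.refl
    ... | false = go (f ∘ suc) i eq

  eval-gate⁻ : ∀ t n (Φ : Fin (suc n) → Formula V) x →
               eval (gate t n Φ) x ≡ absorbing t → ∃[ i ] eval (Φ i) x ≡ absorbing t
  eval-gate⁻ and n Φ x = go (λ i → eval (Φ i) x)
    where
    go : ∀ {n} (f : Fin n → Bool) → foldr _∧_ true f ≡ false → ∃[ i ] f i ≡ false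
    go {suc n} f eq with f zero in f0
    ... | false = zero , f0
    ... | true  = let i , fi = go (f ∘ suc) eq in suc i , fi
  eval-gate⁻ or n Φ x = go (λ i → eval (Φ i) x)
    where
    go : ∀ {n} (f : Fin n → Bool) → foldr _∨_ false f ≡ true → ∃[ i ] f i ≡ true
    go {suc n} f eq with f zero in f0
    ... | true  = zero , f0
    ... | false = let i , fi = go (f ∘ suc) eq in suc i , fi

  eval-≅ : {Φ Ψ : Formula V} → Φ ≅ Ψ → ∀ x → eval Φ x ≡ eval Ψ x
  eval-≅ (const b)   x = ≡.refl
  eval-≅ (lit s v)   x = ≡.refl
  eval-≅ (gate t {n} {Φ} {Ψ} π eqs) x = Bool-ext (absorbing t)
    (λ eq → let i , Φi = eval-gate⁻ t n Φ x eq in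
      eval-gate⁺ t n Ψ x (π ⟨$⟩ʳ i) (≡.trans (≡.sym (eval-≅ (eqs i) x)) Φi))
    (λ eq → let j , Ψj = eval-gate⁻ t n Ψ x eq in
      eval-gate⁺ t n Φ x (π ⟨$⟩ˡ j) (≡.trans (eval-≅ (eqs (π ⟨$⟩ˡ j)) x)
        (≡.trans (≡.cong (λ j → eval (Ψ j) x) (Perm.inverseʳ π)) Ψj)))

  eval-cong : ∀ (Φ : Formula V) {x y} → x ≗ y → eval Φ x ≡ eval Φ y
  eval-cong (const b)    eq = ≡.refl
  eval-cong (lit pos v)  eq = eq v
  eval-cong (lit neg v)  eq = ≡.cong not (eq v)
  eval-cong (gate t n Φ) {x} {y} eq = Bool-ext (absorbing t)
    (λ e → let i , Φi = eval-gate⁻ t n Φ x e in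
      eval-gate⁺ t n Φ y i (≡.trans (≡.sym (eval-cong (Φ i) eq)) Φi))
    (λ e → let i , Φi = eval-gate⁻ t n Φ y e in
      eval-gate⁺ t n Φ x i (≡.trans (eval-cong (Φ i) eq) Φi))

  eval-relabel : ∀ (π : V ↔ V) Φ x → eval (relabel π Φ) x ≡ eval Φ (x ∘ Inverse.to π)
  eval-relabel π (const b)    x = ≡.refl
  eval-relabel π (lit pos v)  x = ≡.refl
  eval-relabel π (lit neg v)  x = ≡.refl
  eval-relabel π (gate t n Φ) x = Bool-ext (absorbing t)
    (λ e → let i , Φi = eval-gate⁻ t n _ x e in
      eval-gate⁺ t n Φ _ i (≡.trans (≡.sym (eval-relabel π (Φ i) x)) Φi))
    (λ e → let i , Φi = eval-gate⁻ t n Φ _ e in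
      eval-gate⁺ t n _ x i (≡.trans (eval-relabel π (Φ i) x) Φi))

  child-image : ∀ (π : V ↔ V) {t n Φ} → relabel π (gate t n Φ) ≅ gate t n Φ →
                ∀ i → ∃[ j ] relabel π (Φ i) ≅ Φ j
  child-image π (gate _ ρ eqs) i = ρ ⟨$⟩ʳ i , eqs i

-- The general lower bound

-- An input X y : V → Bool for every y in the group, on which the group acts by
-- translation; `Z i` consists of the translations that do not affect the i-th block of variables.
record Symmetry (𝔸 : AbelianGroup 0ℓ 0ℓ) (V : Set) (k : ℕ) : Set₁ where
  open Subgroups 𝔸
  field
    act      : A → V ↔ V
    act-cong : ∀ {u w} → u ≈ w → ∀ v → Inverse.to (act u) v ≡ Inverse.to (act w) v
    act-ε    : ∀ v → Inverse.to (act ε) v ≡ v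
    act-∙    : ∀ u w v → Inverse.to (act u) (Inverse.to (act w) v) ≡ Inverse.to (act (u ∙ w)) v
    X        : A → V → Bool
    X-cong   : ∀ {y z} → y ≈ z → ∀ v → X y v ≡ X z v
    X-act    : ∀ u y v → X y (Inverse.to (act u) v) ≡ X (u ∙ y) v
    block    : V → Fin k
    Z        : Fin k → Subgroup
    X-Z      : ∀ v {z} → Z (block v) ∋ z → ∀ y → X (z ∙ y) v ≡ X y v

module LowerBound {p : ℕ} (p-prime : Prime p) (e : ℕ) (𝔸 : AbelianGroup 0ℓ 0ℓ) {V : Set} {k : ℕ}
                  (symmetry : Symmetry 𝔸 V k) where

  open Subgroups 𝔸
  open Symmetry symmetry
  open Helly Z

  private
    r : ℕ
    r = p ^ e

  act-⁻¹ : ∀ u Φ → relabel (act (u ⁻¹)) (relabel (act u) Φ) ≅ Φ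
  act-⁻¹ u Φ = ≅-trans
    (relabel-∘ _ _ (act ε) (λ v → ≡.trans (act-∙ (u ⁻¹) u v) (act-cong (inverseˡ u) v)) Φ)
    (relabel-id (act ε) act-ε Φ)

  Stab : Formula V → Subgroup
  Stab Φ = record
    { _∋_  = λ u → relabel (act u) Φ ≅ Φ
    ; resp = λ eq stab → ≅-trans (≅-sym (relabel-cong _ _ (act-cong eq) Φ)) stab
    ; ε∈   = relabel-id (act ε) act-ε Φ
    ; ∙∈   = λ {u} {w} su sw → ≅-trans (≅-sym (relabel-∘ (act u) (act w) _ (act-∙ u w) Φ))
                                 (≅-trans (relabel-≅ (act u) sw) su)
    ; ⁻¹∈  = λ {u} su → ≅-trans (≅-sym (relabel-≅ (act (u ⁻¹)) su)) (act-⁻¹ u Φ)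
    }

  eval-invariant : ∀ {Φ u} → Stab Φ ∋ u → ∀ y → eval Φ (X (u ∙ y)) ≡ eval Φ (X y)
  eval-invariant {Φ} {u} su y = ≡.trans (≡.sym (eval-cong Φ (X-act u y)))
    (≡.trans (≡.sym (eval-relabel (act u) Φ (X y))) (eval-≅ su (X y)))

  -- Applying w⁻¹ brings both images back to Φ; this is the injective half of the orbit-stabiliser
  -- correspondence.
  stab-same-image : ∀ {Φ Ψ u w} → relabel (act u) Φ ≅ Ψ → relabel (act w) Φ ≅ Ψ → Stab Φ ∋ u - w
  stab-same-image {Φ} {Ψ} {u} {w} su sw = resp (Stab Φ) (comm (w ⁻¹) u)
    (≅-trans (≅-sym (relabel-∘ _ _ _ (act-∙ (w ⁻¹) u) Φ))
    (≅-trans (relabel-≅ (act (w ⁻¹)) (≅-trans su (≅-sym sw))) (act-⁻¹ w Φ)))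

  module _ (Γ : Subgroup)
           (torsion : ∀ {u} → Γ ∋ u → ∀ v → Inverse.to (act ((p ^ suc e) · u)) v ≡ v) where

    -- The socle of U, pulled back along multiplication by p^e. For U containing p^(e+1) Γ
    -- this makes [Γ : Socle U] the index of the socle of U in that of Γ.
    Socle : Subgroup → Subgroup
    Socle U = Γ ⊓ Preimage r U

    -- Survives the passage to stabilisers of children, because p^(e+1) Γ acts trivially. It makes
    -- quotients of socles vector spaces over the field of p elements.
    Full : Subgroup → Set
    Full U = ∀ {x} → Γ ∋ x → U ∋ (p ^ suc e) · x

    socle-torsion : ∀ {U D} → Full D → ∀ {x} → Socle U ∋ x → Socle D ∋ p · x
    socle-torsion {D = D} full {x} (x∈ , _) = ·∈ Γ p x∈ ,
      resp D (trans (·-congˡ (*-comm p r)) (sym (·-assocˡ x r p))) (full x∈)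

    -- D is the stabiliser of a path from Φ to a leaf; its conjugates under U are counted by `bound`.
    record Descent (U : Subgroup) (c : ℕ) (Φ : Formula V) : Set₁ where
      field
        D      : Subgroup
        D⊑U    : D ⊑ U
        D-full : Full D
        {N}    : ℕ
        chain  : Chain (Socle U) (Socle D) N
        cost   : Cost k (depth Φ) c N
        bound  : ∀ {n} → Separated U D n → n ≤ size Φ

    -- The contrapositive of: if translation by p^e x changes Φ, there is a descent.
    Claim : Formula V → Set₁
    Claim Φ = ∀ U → U ⊑ Stab Φ → Full U →
              ∀ c x y → LocallyIn c (Socle U) x → ¬ Descent U c Φ →
              eval Φ (X (r · x ∙ y)) ≡ eval Φ (X y)

    -- If k ≤ c, the path ending at this literal is already a descent, with D = U. Otherwise `local`
    -- applies to the single block of v: x is the sum of some s′ for which p^e s′ fixes v and an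
    -- element that does not affect the block.
    claim-lit : ∀ s v → Claim (lit s v)
    claim-lit s v U U⊑Stab full c x y local ¬descent = eval-lit s stable
      where
      eval-lit : ∀ s {x y} → x v ≡ y v → eval (lit s v) x ≡ eval (lit s v) y
      eval-lit pos eq = eq
      eval-lit neg eq = ≡.cong not eq

      fixed : ∀ {s u} → relabel (act u) (lit s v) ≅ lit s v → Inverse.to (act u) v ≡ v
      fixed {s} {u} iso = go iso ≡.refl
        where
        go : ∀ {w Φ} → lit s w ≅ Φ → Φ ≡ lit s v → w ≡ v
        go (lit _ _) ≡.refl = ≡.refl

      small : ∀ {n} → Separated U U n → n ≤ 1
      small {zero}        _ = z≤n
      small {suc zero}    _ = s≤s z≤n
      small {suc (suc n)} (separated f f∈ sep) with () ← sep zero (suc zero) (-∈ U (f∈ _) (f∈ _))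

      agree : (Socle U ⊞ Z[ block v ∷ [] ]) ∋ x → X (r · x ∙ y) v ≡ X y v
      agree (s′ , (_ , rs′∈) , x-s′∈) = begin
        X (r · x ∙ y) v                         ≡⟨ X-cong eq v ⟩
        X (r · (x - s′) ∙ (r · s′ ∙ y)) v       ≡⟨ X-Z v (·∈ (Z (block v)) r (x-s′∈ (here ≡.refl))) _ ⟩
        X (r · s′ ∙ y) v                        ≡⟨ X-act (r · s′) y v ⟨
        X y (Inverse.to (act (r · s′)) v)       ≡⟨ ≡.cong (X y) (fixed (U⊑Stab rs′∈)) ⟩
        X y v                                   ∎
        where
        open ≡.≡-Reasoning
        eq : r · x ∙ y ≈ r · (x - s′) ∙ (r · s′ ∙ y)
        eq = sym (trans (sym (assoc _ _ _)) (∙-congʳ (·-split r x s′)))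

      stable : X (r · x ∙ y) v ≡ X y v
      stable with X (r · x ∙ y) v ≟ᵇ X y v
      ... | yes eq = eq
      ... | no ¬eq = ⊥-elim (local (block v ∷ []) 1*c<k (¬eq ∘ agree))
        where
        1*c<k : 1 * c < k
        1*c<k = ≰⇒> λ k≤c → ¬descent record
          { D = U ; D⊑U = λ u → u ; D-full = full ; chain = done (λ u → u)
          ; cost = done (≤-trans k≤c (≤-reflexive (*-identityˡ c))) ; bound = small }

    module Gate (t : GateType) (l : ℕ) (Φ : Fin (suc l) → Formula V) (ih : ∀ i → Claim (Φ i))
                (U : Subgroup) (U⊑Stab : U ⊑ Stab (gate t l Φ))
                (full : Full U) (i : Fin (suc l)) where

      U₁ : Subgroup
      U₁ = U ⊓ Stab (Φ i)

      full₁ : Full U₁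
      full₁ x∈ = full x∈ , relabel-id _ (torsion x∈) (Φ i)

      Socle₁⊑Socle : Socle U₁ ⊑ Socle U
      Socle₁⊑Socle (x∈ , rx∈ , _) = x∈ , rx∈

      image : ∀ {u} → U ∋ u → Fin (suc l)
      image u∈ = proj₁ (child-image _ (U⊑Stab u∈) i)

      image-≅ : ∀ {u} (u∈ : U ∋ u) → relabel (act u) (Φ i) ≅ Φ (image u∈)
      image-≅ u∈ = proj₂ (child-image _ (U⊑Stab u∈) i)

      same-image : ∀ {u w} (u∈ : U ∋ u) (w∈ : U ∋ w) → image u∈ ≡ image w∈ → U₁ ∋ u - w
      same-image u∈ w∈ eq = -∈ U u∈ w∈ ,
        stab-same-image (image-≅ u∈) (≡.subst (λ j → _ ≅ Φ j) (≡.sym eq) (image-≅ w∈))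

      index-bound : ∀ {n} → Separated U U₁ n → n ≤ suc l
      index-bound (separated f f∈ sep) =
        injective⇒≤ {f = λ a → image (f∈ a)} λ eq → sep _ _ (same-image (f∈ _) (f∈ _) eq)

      -- Multiplication by p^e carries representatives from the socle into U, so a chain of length n
      -- gives p^n > n cosets of U₁ and as many children. This makes `search` terminate.
      chain-bound : ∀ {n} → Chain (Socle U) (Socle U₁) n → n < suc l
      chain-bound {n} chain = <-≤-trans (n<p^n (nonTrivial⇒n>1 p {{prime⇒nonTrivial p-prime}}) n)
        (index-bound (scale (chain⇒separated p-prime (socle-torsion {U} {U₁} full₁) chain)))
        where
        scale : ∀ {n} → Separated (Socle U) (Socle U₁) n → Separated U U₁ n
        scale (separated f f∈ sep) = separated (λ a → r · f a) (λ a → proj₂ (f∈ a))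
          λ a b d → sep a b (-∈ Γ (proj₁ (f∈ a)) (proj₁ (f∈ b)) ,
            resp U₁ (sym (·-distrib-- r (f a) (f b))) d)

      -- Representatives are sorted by the child to which they send Φ i. Within a fibre, differences
      -- from the first one lie in U₁, so `bound` limits the fibre by the size of Φ i, which is the
      -- size of that child.
      orbit-bound : ∀ D → (∀ {n} → Separated U₁ D n → n ≤ size (Φ i)) →
                    ∀ {n} → Separated U D n → n ≤ size (gate t l Φ)
      orbit-bound D bound (separated f f∈ sep) = fibres-bound (λ a → image (f∈ a)) (λ j → size (Φ j)) fibre
        where
        fibre : ∀ j {m} (g : Fin m → Fin _) → Injective _≡_ _≡_ g →
                (∀ a → image (f∈ (g a)) ≡ j) → m ≤ size (Φ j)
        fibre j {zero}  g g-inj g-fib = z≤n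
        fibre j {suc m} g g-inj g-fib = ≤-trans
          (bound (separated (λ a → f (g a) - f (g zero))
            (λ a → same-image (f∈ _) (f∈ _) (≡.trans (g-fib a) (≡.sym (g-fib zero))))
            λ a b d → g-inj (sep _ _ (resp D (-‿cancelʳ (f (g a)) (f (g b)) (f (g zero))) d))))
          (≤-reflexive (≡.trans (≡.sym (size-relabel (act (f (g zero))) (Φ i)))
            (size-≅ (≡.subst (λ j → _ ≅ Φ j) (g-fib zero) (image-≅ (f∈ (g zero)))))))

      lift-descent : ∀ {c n} → Chain (Socle U) (Socle U₁) n →
                     Descent U₁ (c * suc n) (Φ i) → Descent U c (gate t l Φ)
      lift-descent {n = n} chain₁ descent = record
        { D      = D
        ; D⊑U    = λ d → proj₁ (D⊑U d)
        ; D-full = D-full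
        ; chain  = chain-++ chain₁ chain
        ; cost   = cost-mono (depth-child t l Φ i) (step n cost)
        ; bound  = orbit-bound D bound
        }
        where open Descent descent

      -- The value of the gate survives the translation by r x: move to x₁ ∈ x + Socle U, for
      -- which the i-th child does not change (else it yields a descent), and return by U-invariance.
      module _ (c : ℕ) (x y : A) (local : LocallyIn c (Socle U) x)
               (¬descent : ¬ Descent U c (gate t l Φ))
               (Φi≡a : eval (Φ i) (X y) ≡ absorbing t) where

        found : ∀ {n} → Chain (Socle U) (Socle U₁) n → Found (c * suc n) (Socle U) (Socle U₁) x →
                eval (gate t l Φ) (X (r · x ∙ y)) ≡ absorbing t
        found {n} chain (x₁ , (_ , rd∈) , local₁) = ≡.trans (≡.sym back)
          (eval-gate⁺ t l Φ _ i (≡.trans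
            (ih i U₁ proj₂ full₁ (c * suc n) x₁ y local₁ (¬descent ∘ lift-descent chain)) Φi≡a))
          where
          eq : r · (x₁ - x) ∙ (r · x ∙ y) ≈ r · x₁ ∙ y
          eq = trans (sym (assoc _ _ _)) (∙-congʳ (·-split r x₁ x))
          back : eval (gate t l Φ) (X (r · x₁ ∙ y)) ≡ eval (gate t l Φ) (X (r · x ∙ y))
          back = ≡.trans (≡.sym (eval-cong (gate t l Φ) (X-cong eq)))
            (eval-invariant (U⊑Stab rd∈) (r · x ∙ y))

        -- Whenever Helly's theorem finds no x₁ at the price n + 1, it supplies a chain of length n
        -- + 1, and n is raised. Hence a price of n + 1 is only ever paid with a chain of length n
        -- at hand.
        search : ∀ fuel n → suc l ≤ n + fuel → Chain (Socle U) (Socle U₁) n →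
                 ¬ ¬ (eval (gate t l Φ) (X (r · x ∙ y)) ≡ absorbing t)
        search zero       n enough chain _  =
          <⇒≱ (chain-bound chain) (≤-trans enough (≤-reflexive (+-identityʳ n)))
        search (suc fuel) n enough chain ¬a =
          helly (Socle U) (Socle U₁) Socle₁⊑Socle c x local n (¬a ∘ found chain)
            λ chain′ → search fuel (suc n) (≤-trans enough (≤-reflexive (+-suc n fuel))) chain′ ¬a

        translate : eval (gate t l Φ) (X (r · x ∙ y)) ≡ absorbing t
        translate with eval (gate t l Φ) (X (r · x ∙ y)) ≟ᵇ absorbing t
        ... | yes eq = eq
        ... | no ¬eq = ⊥-elim (search (suc l) 0 ≤-refl (done Socle₁⊑Socle) ¬eq)

    claim : ∀ Φ → Claim Φ
    claim (const b)    U U⊑Stab full c x y local ¬descent = ≡.refl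
    claim (lit s v)    = claim-lit s v
    claim (gate t l Φ) U U⊑Stab full c x y local ¬descent = Bool-ext (absorbing t)
      -- The converse is the forward direction for x⁻¹ at the translated input.
      (λ eq → ≡.trans (≡.sym (eval-cong (gate t l Φ) (X-cong undo)))
        (forward (x ⁻¹) (r · x ∙ y) (λ Q small ∉ → local Q small (∉ ∘ ⁻¹∈ (Socle U ⊞ Z[ Q ]))) eq))
      (forward x y local)
      where
      forward : ∀ x y → LocallyIn c (Socle U) x → eval (gate t l Φ) (X y) ≡ absorbing t →
                eval (gate t l Φ) (X (r · x ∙ y)) ≡ absorbing t
      forward x y local eq = let i , Φi = eval-gate⁻ t l Φ (X y) eq in
        Gate.translate t l Φ (λ i → claim (Φ i)) U U⊑Stab full i c x y local ¬descent Φi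
      undo : r · (x ⁻¹) ∙ (r · x ∙ y) ≈ y
      undo = trans (sym (assoc _ _ _)) (trans
        (∙-congʳ (trans (∙-congʳ (·-homo-⁻¹ r x)) (inverseˡ (r · x))))
        (identityˡ y))

    -- The claim is applied at the root, with U = Γ and c = 1, and a change of value forces a
    -- descent. Its drop N in the socle gives p^N cosets, which the e + 1 layers amplify to
    -- (p^N)^(e+1).
    size-bound : ∀ {Φ x y} → Γ ⊑ Stab Φ → LocallyIn 1 Γ x → eval Φ (X (r · x ∙ y)) ≢ eval Φ (X y) →
                 ¬ ¬ (∃[ N ] Cost k (depth Φ) 1 N × (p ^ suc e) ^ N ≤ size Φ)
    size-bound {Φ} {x} {y} Γ⊑Stab local nonconst ¬bound =
      nonconst (claim Φ Γ Γ⊑Stab (·∈ Γ (p ^ suc e)) 1 x y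
        (λ Q small ∉ → local Q small λ (s , s∈ , z∈) → ∉ (s , (s∈ , ·∈ Γ r s∈) , z∈))
        λ descent → ¬bound (conclude descent))
      where
      conclude : Descent Γ 1 Φ → ∃[ N ] Cost k (depth Φ) 1 N × (p ^ suc e) ^ N ≤ size Φ
      conclude descent = N , cost , ≤-trans (≤-reflexive swap-exponents)
        (bound (separated-layers Γ e D D⊑U D-full
          (separated-mono proj₁ (λ d → d) (chain⇒separated p-prime (socle-torsion {Γ} {D} D-full) chain))))
        where
        open Descent descent
        swap-exponents : (p ^ suc e) ^ N ≡ (p ^ N) ^ suc e
        swap-exponents = ≡.trans (^-*-assoc p (suc e) N)
          (≡.trans (≡.cong (p ^_) (*-comm (suc e) N)) (≡.sym (^-*-assoc p N (suc e))))

-- Products of permutation matrices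

⌊⌋-⇔ : {P Q : Set} (P? : Dec P) (Q? : Dec Q) → (P → Q) → (Q → P) → ⌊ P? ⌋ ≡ ⌊ Q? ⌋
⌊⌋-⇔ (yes p) (yes q) f g = ≡.refl
⌊⌋-⇔ (yes p) (no ¬q) f g = ⊥-elim (¬q (f p))
⌊⌋-⇔ (no ¬p) (yes q) f g = ⊥-elim (¬p (g q))
⌊⌋-⇔ (no ¬p) (no ¬q) f g = ≡.refl

indicator : Bool → ℕ
indicator b = if b then 1 else 0

sum-0 : ∀ {n} (f : Fin n → ℕ) → (∀ c → f c ≡ 0) → sum +-0-monoid f ≡ 0
sum-0 {zero}  f f≡0 = ≡.refl
sum-0 {suc n} f f≡0 = ≡.cong₂ _+_ (f≡0 zero) (sum-0 (f ∘ suc) (f≡0 ∘ suc))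

sum-single : ∀ {n} (f : Fin n → ℕ) c₀ → (∀ c → c ≢ c₀ → f c ≡ 0) → sum +-0-monoid f ≡ f c₀
sum-single f zero     f≡0 = ≡.trans (≡.cong (λ m → f zero + m) (sum-0 (f ∘ suc) λ c → f≡0 (suc c) λ ()))
                                    (+-identityʳ (f zero))
sum-single f (suc c₀) f≡0 = ≡.cong₂ _+_ (f≡0 zero λ ())
  (sum-single (f ∘ suc) c₀ λ c c≢c₀ → f≡0 (suc c) λ { ≡.refl → c≢c₀ ≡.refl })

perm-injective : ∀ {n} (π : Permutation′ n) {a b} → π ⟨$⟩ʳ a ≡ π ⟨$⟩ʳ b → a ≡ b
perm-injective π eq = ≡.trans (≡.sym (Perm.inverseˡ π)) (≡.trans (≡.cong (π ⟨$⟩ˡ_) eq) (Perm.inverseˡ π))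

-- The matrix of ρ⁻¹ π, in a form in which a common factor of π and ρ cancels.
ratio : ∀ {n} → Permutation′ n → Permutation′ n → Fin n → Fin n → Bool
ratio π ρ a b = ⌊ π ⟨$⟩ʳ a ≟ᶠ ρ ⟨$⟩ʳ b ⌋

-- The quotients telescope: in the sum for the first factor only c₀ = y₁⁻¹ (y₀ a) contributes.
ratio-product : ∀ {n} k (y : Fin (suc k) → Permutation′ n) a b →
  foldr _⊗_ 𝟙 (λ i a b → indicator (ratio (y (inject₁ i)) (y (suc i)) a b)) a b ≡
  indicator (ratio (y zero) (y (fromℕ k)) a b)
ratio-product zero    y a b =
  ≡.cong indicator (⌊⌋-⇔ (a ≟ᶠ b) _ (≡.cong (y zero ⟨$⟩ʳ_)) (perm-injective (y zero)))
ratio-product {n} (suc k) y a b = ≡.trans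
  (sum-cong-≗ +-0-monoid λ c → ≡.cong (entry c *_) (ratio-product k (y ∘ suc) c b))
  (≡.trans (sum-single _ c₀ off-diagonal) diagonal)
  where
  y₁ = y (suc zero)
  z  = y (suc (fromℕ k))
  entry : Fin n → ℕ
  entry c = indicator (ratio (y zero) y₁ a c)
  c₀ : Fin n
  c₀ = y₁ ⟨$⟩ˡ (y zero ⟨$⟩ʳ a)
  y₁c₀ : y₁ ⟨$⟩ʳ c₀ ≡ y zero ⟨$⟩ʳ a
  y₁c₀ = Perm.inverseʳ y₁
  off-diagonal : ∀ c → c ≢ c₀ → entry c * indicator (ratio y₁ z c b) ≡ 0
  off-diagonal c c≢c₀ with y zero ⟨$⟩ʳ a ≟ᶠ y₁ ⟨$⟩ʳ c
  ... | yes eq = ⊥-elim (c≢c₀ (perm-injective y₁ (≡.trans (≡.sym eq) (≡.sym y₁c₀))))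
  ... | no  _  = ≡.refl
  diagonal : entry c₀ * indicator (ratio y₁ z c₀ b) ≡ indicator (ratio (y zero) z a b)
  diagonal rewrite y₁c₀ with y zero ⟨$⟩ʳ a ≟ᶠ y zero ⟨$⟩ʳ a
  ... | yes _ = +-identityʳ _
  ... | no ¬r = ⊥-elim (¬r ≡.refl)

-- Pigeonhole: if Q contained every i, then positions in Q would embed `Fin k` into
-- `Fin (length Q)`.
missing : ∀ {k} (Q : List (Fin k)) → length Q < k → ∃[ i ] i ∉ Q
missing {k} Q small with any? (λ i → ¬? (DecMembership._∈?_ _≟ᶠ_ i Q))
... | yes found = found
... | no ¬found = ⊥-elim (<⇒≱ small (injective⇒≤ {f = λ i → index (all∈ i)}
        λ {i} {j} eq → index-injective (≡.setoid (Fin k)) (all∈ i) (all∈ j) eq))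
  where
  all∈ : ∀ i → i ∈ Q
  all∈ i = decidable-stable (DecMembership._∈?_ _≟ᶠ_ i Q) λ i∉ → ¬found (i , i∉)

^ₚ-+ : ∀ {n} (σ : Permutation′ n) i j a → (σ ^ₚ (i + j)) ⟨$⟩ʳ a ≡ (σ ^ₚ j) ⟨$⟩ʳ ((σ ^ₚ i) ⟨$⟩ʳ a)
^ₚ-+ σ zero    j a = ≡.refl
^ₚ-+ σ (suc i) j a = ^ₚ-+ σ i j (σ ⟨$⟩ʳ a)

-- The symmetry of Word

module WordSymmetry {n : ℕ} (C : Pred (Permutation′ n) 0ℓ)
                    (C-group : IsSubgroup C) (C-cyclic : IsCyclicOfOrder n C) where

  open IsSubgroup C-group
  open IsCyclicOfOrder C-cyclic

  powers-commute : ∀ i j a → (generator ^ₚ i) ⟨$⟩ʳ ((generator ^ₚ j) ⟨$⟩ʳ a) ≡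
                             (generator ^ₚ j) ⟨$⟩ʳ ((generator ^ₚ i) ⟨$⟩ʳ a)
  powers-commute i j a = ≡.trans (≡.sym (^ₚ-+ generator j i a))
    (≡.trans (≡.cong (λ m → (generator ^ₚ m) ⟨$⟩ʳ a) (+-comm j i)) (^ₚ-+ generator i j a))

  commute : ∀ {π ρ} → C π → C ρ → ∀ a → ρ ⟨$⟩ʳ (π ⟨$⟩ʳ a) ≡ π ⟨$⟩ʳ (ρ ⟨$⟩ʳ a)
  commute {π} {ρ} π∈ ρ∈ a = begin
    ρ ⟨$⟩ʳ (π ⟨$⟩ʳ a)                        ≡⟨ ρ≈ (π ⟨$⟩ʳ a) ⟩
    (generator ^ₚ j) ⟨$⟩ʳ (π ⟨$⟩ʳ a)         ≡⟨ ≡.cong ((generator ^ₚ j) ⟨$⟩ʳ_) (π≈ a) ⟩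
    (generator ^ₚ j) ⟨$⟩ʳ ((generator ^ₚ i) ⟨$⟩ʳ a) ≡⟨ powers-commute j i a ⟩
    (generator ^ₚ i) ⟨$⟩ʳ ((generator ^ₚ j) ⟨$⟩ʳ a) ≡⟨ π≈ ((generator ^ₚ j) ⟨$⟩ʳ a) ⟨
    π ⟨$⟩ʳ ((generator ^ₚ j) ⟨$⟩ʳ a)         ≡⟨ ≡.cong (π ⟨$⟩ʳ_) (ρ≈ a) ⟨
    π ⟨$⟩ʳ (ρ ⟨$⟩ʳ a)                        ∎
    where
    open ≡.≡-Reasoning
    i = proj₁ (generates π∈)
    π≈ = proj₂ (generates π∈)
    j = proj₁ (generates ρ∈)
    ρ≈ = proj₂ (generates ρ∈)

  ℂ : AbelianGroup 0ℓ 0ℓ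
  ℂ = record
    { Carrier = ∃[ π ] C π
    ; _≈_     = λ (π , _) (ρ , _) → ∀ a → π ⟨$⟩ʳ a ≡ ρ ⟨$⟩ʳ a
    ; _∙_     = λ (π , π∈) (ρ , ρ∈) → π ∘ₚ ρ , ∘-closed π∈ ρ∈
    ; ε       = Perm.id , id-closed
    ; _⁻¹     = λ (π , π∈) → flip π , inv-closed π∈
    ; isAbelianGroup = record
      { isGroup = record
        { isMonoid = record
          { isSemigroup = record
            { isMagma = record
              { isEquivalence = record
                { refl  = λ _ → ≡.refl
                ; sym   = λ eq a → ≡.sym (eq a)
                ; trans = λ eq eq′ a → ≡.trans (eq a) (eq′ a)
                }
              ; ∙-cong = λ {_} {_} {(ρ , _)} eq eq′ a → ≡.trans (≡.cong (ρ ⟨$⟩ʳ_) (eq a)) (eq′ _)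
              }
            ; assoc = λ _ _ _ _ → ≡.refl
            }
          ; identity = (λ _ _ → ≡.refl) , (λ _ _ → ≡.refl)
          }
        ; inverse = (λ (π , _) _ → Perm.inverseʳ π) , (λ (π , _) _ → Perm.inverseˡ π)
        ; ⁻¹-cong = λ {(π , _)} {(ρ , _)} eq a → perm-injective π
            (≡.trans (Perm.inverseʳ π) (≡.sym (≡.trans (eq _) (Perm.inverseʳ ρ))))
        }
      ; comm = λ (π , π∈) (ρ , ρ∈) → commute π∈ ρ∈
      }
    }

  module ℂ = Subgroups ℂ

  σ : ℂ.A
  σ = generator , generator∈G

  ·-^ₚ : ∀ m a → proj₁ (m ℂ.· σ) ⟨$⟩ʳ a ≡ (generator ^ₚ m) ⟨$⟩ʳ a
  ·-^ₚ zero    a = ≡.refl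
  ·-^ₚ (suc m) a = ·-^ₚ m (generator ⟨$⟩ʳ a)

  -- Each element is a multiple j · σ, and n · (j · σ) = j · (n · σ).
  exponent : ∀ c → n ℂ.· c ℂ.≈ ℂ.ε
  exponent c@(π , π∈) = begin
    n ℂ.· c           ≈⟨ ℂ.·-congʳ n {c} {j ℂ.· σ} (λ a → ≡.trans (π≈ a) (≡.sym (·-^ₚ j a))) ⟩
    n ℂ.· (j ℂ.· σ)   ≈⟨ ℂ.·-assocˡ σ n j ⟩
    (n * j) ℂ.· σ     ≈⟨ ℂ.·-congˡ {σ} (*-comm n j) ⟩
    (j * n) ℂ.· σ     ≈⟨ ℂ.·-assocˡ σ j n ⟨
    j ℂ.· (n ℂ.· σ)   ≈⟨ ℂ.·-congʳ j {n ℂ.· σ} {ℂ.ε} (λ a → ≡.trans (·-^ₚ n a) (power-r a)) ⟩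
    j ℂ.· ℂ.ε         ≈⟨ multiple-ε j ⟩
    ℂ.ε               ∎
    where
    open import Relation.Binary.Reasoning.Setoid ℂ.setoid
    j = proj₁ (generates π∈)
    π≈ = proj₂ (generates π∈)
    multiple-ε : ∀ j → j ℂ.· ℂ.ε ℂ.≈ ℂ.ε
    multiple-ε zero    _ = ≡.refl
    multiple-ε (suc j) = multiple-ε j

  module _ (k : ℕ) where

    𝔸 : AbelianGroup 0ℓ 0ℓ
    𝔸 = Pointwise.abelianGroup (Fin (suc k)) ℂ

    open Subgroups 𝔸

    ·-pointwise : ∀ m (u : A) j → (m · u) j ≡ m ℂ.· u j
    ·-pointwise zero    u j = ≡.refl
    ·-pointwise (suc m) u j = ≡.cong (u j ℂ.∙_) (·-pointwise m u j)

    ⟦_⟧ : A → Fin (suc k) → Permutation′ n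
    ⟦ u ⟧ j = proj₁ (u j)

    act : A → Var k n ↔ Var k n
    act u = mk↔ₛ′
      (λ (i , a , b) → i , ⟦ u ⟧ (inject₁ i) ⟨$⟩ʳ a , ⟦ u ⟧ (suc i) ⟨$⟩ʳ b)
      (λ (i , a , b) → i , ⟦ u ⟧ (inject₁ i) ⟨$⟩ˡ a , ⟦ u ⟧ (suc i) ⟨$⟩ˡ b)
      (λ (i , a , b) → ≡.cong (i ,_)
        (≡.cong₂ _,_ (Perm.inverseʳ (⟦ u ⟧ (inject₁ i))) (Perm.inverseʳ (⟦ u ⟧ (suc i)))))
      (λ (i , a , b) → ≡.cong (i ,_)
        (≡.cong₂ _,_ (Perm.inverseˡ (⟦ u ⟧ (inject₁ i))) (Perm.inverseˡ (⟦ u ⟧ (suc i)))))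

    input : A → Var k n → Bool
    input y (i , a , b) = ratio (⟦ y ⟧ (inject₁ i)) (⟦ y ⟧ (suc i)) a b

    -- A translation with equal values on both sides of the i-th matrix cancels in it, by
    -- commutativity.
    Flat : Fin k → Subgroup
    Flat i = record
      { _∋_  = λ z → z (inject₁ i) ℂ.≈ z (suc i)
      ; resp = λ eq z≈ a → ≡.trans (≡.sym (eq (inject₁ i) a)) (≡.trans (z≈ a) (eq (suc i) a))
      ; ε∈   = λ _ → ≡.refl
      ; ∙∈   = λ {z} {w} → ℂ.∙-cong {z (inject₁ i)} {z (suc i)} {w (inject₁ i)} {w (suc i)}
      ; ⁻¹∈  = λ {z} → ℂ.⁻¹-cong {z (inject₁ i)} {z (suc i)}
      }

    symmetry : Symmetry 𝔸 (Var k n) k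
    symmetry = record
      { act      = act
      ; act-cong = λ eq (i , a , b) → ≡.cong (i ,_) (≡.cong₂ _,_ (eq (inject₁ i) a) (eq (suc i) b))
      ; act-ε    = λ _ → ≡.refl
      ; act-∙    = λ u w (i , a , b) → ≡.cong (i ,_) (≡.cong₂ _,_
          (commute (proj₂ (w (inject₁ i))) (proj₂ (u (inject₁ i))) a)
          (commute (proj₂ (w (suc i))) (proj₂ (u (suc i))) b))
      ; X        = input
      ; X-cong   = λ eq (i , a , b) → ≡.cong₂ (λ a b → ⌊ a ≟ᶠ b ⌋) (eq (inject₁ i) a) (eq (suc i) b)
      ; X-act    = λ _ _ _ → ≡.refl
      ; block    = proj₁
      ; Z        = Flat
      ; X-Z      = input-flat
      }
      where
      input-flat : ∀ v {z} → Flat (proj₁ v) ∋ z → ∀ y → input (z ∙ y) v ≡ input y v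
      input-flat (i , a , b) {z} flat y = ⌊⌋-⇔ _ _
        (λ eq → perm-injective (⟦ z ⟧ (suc i))
          (≡.trans (≡.sym left) (≡.trans eq right)))
        (λ eq → ≡.trans left (≡.trans (≡.cong (⟦ z ⟧ (suc i) ⟨$⟩ʳ_) eq) (≡.sym right)))
        where
        left : ⟦ y ⟧ (inject₁ i) ⟨$⟩ʳ (⟦ z ⟧ (inject₁ i) ⟨$⟩ʳ a) ≡
               ⟦ z ⟧ (suc i) ⟨$⟩ʳ (⟦ y ⟧ (inject₁ i) ⟨$⟩ʳ a)
        left = ≡.trans (≡.cong (⟦ y ⟧ (inject₁ i) ⟨$⟩ʳ_) (flat a))
          (commute (proj₂ (z (suc i))) (proj₂ (y (inject₁ i))) a)
        right : ⟦ y ⟧ (suc i) ⟨$⟩ʳ (⟦ z ⟧ (suc i) ⟨$⟩ʳ b) ≡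
                ⟦ z ⟧ (suc i) ⟨$⟩ʳ (⟦ y ⟧ (suc i) ⟨$⟩ʳ b)
        right = commute (proj₂ (z (suc i))) (proj₂ (y (suc i))) b

    Γ : Subgroup
    Γ = record
      { _∋_  = λ u → u zero ℂ.≈ ℂ.ε × u (fromℕ k) ℂ.≈ ℂ.ε
      ; resp = λ eq (z , l) → (λ a → ≡.trans (≡.sym (eq zero a)) (z a)) ,
                              (λ a → ≡.trans (≡.sym (eq (fromℕ k) a)) (l a))
      ; ε∈   = (λ _ → ≡.refl) , (λ _ → ≡.refl)
      ; ∙∈   = λ {u} {w} (z , l) (z′ , l′) →
                 ℂ.∙-cong {u zero} {ℂ.ε} {w zero} {ℂ.ε} z z′ ,
                 ℂ.∙-cong {u (fromℕ k)} {ℂ.ε} {w (fromℕ k)} {ℂ.ε} l l′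
      ; ⁻¹∈  = λ {u} (z , l) → ℂ.⁻¹-cong {u zero} {ℂ.ε} z , ℂ.⁻¹-cong {u (fromℕ k)} {ℂ.ε} l
      }

    -- All jumps are congruent modulo Γ, and `jump i` is flat except at i.
    jump : ∀ {l} → Fin l → Fin (suc l) → ℂ.A
    jump i       zero    = ℂ.ε
    jump zero    (suc j) = σ
    jump (suc i) (suc j) = jump i j

    jump-last : ∀ {l} (i : Fin l) → jump i (fromℕ l) ≡ σ
    jump-last zero    = ≡.refl
    jump-last (suc i) = jump-last i

    jump-flat : ∀ {l} (i i′ : Fin l) → i′ ≢ i → jump i (inject₁ i′) ≡ jump i (suc i′)
    jump-flat zero    zero     ≢ = ⊥-elim (≢ ≡.refl)
    jump-flat zero    (suc i′) ≢ = ≡.refl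
    jump-flat (suc zero)    zero     ≢ = ≡.refl
    jump-flat (suc (suc i)) zero     ≢ = ≡.refl
    jump-flat (suc i) (suc i′) ≢ = jump-flat i i′ (≢ ∘ ≡.cong suc)

    open Helly Flat

    -- A small Q misses some i. Then `jump i` is flat on Q, and `jump i₀ - jump i` lies in Γ because
    -- both jumps have the same end values.
    jump-local : (i₀ : Fin k) → LocallyIn 1 Γ (jump i₀)
    jump-local i₀ Q small ∉ = let i , i∉ = missing Q (≡.subst (_< k) (*-identityʳ (length Q)) small) in
      ∉ (jump i₀ - jump i , difference i , λ {i′} i′∈ →
        resp (Flat i′) {jump i} {jump i₀ - (jump i₀ - jump i)}
          (sym {jump i₀ - (jump i₀ - jump i)} {jump i} (x-[x-y]≈y (jump i₀) (jump i)))
          λ a → ≡.cong (λ c → proj₁ c ⟨$⟩ʳ a) (jump-flat i i′ λ { ≡.refl → i∉ i′∈ }))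
      where
      difference : ∀ i → Γ ∋ jump i₀ - jump i
      difference i = (λ _ → ≡.refl) , λ a → ≡.subst₂ (λ c c′ → proj₁ (c ℂ.- c′) ⟨$⟩ʳ a ≡ a)
        (≡.sym (jump-last i₀)) (≡.sym (jump-last i)) (ℂ.inverseʳ σ a)

    torsion : ∀ u → Γ ∋ u → ∀ v → Inverse.to (act (n · u)) v ≡ v
    torsion u _ (i , a , b) = ≡.cong (i ,_) (≡.cong₂ _,_ (kill (inject₁ i) a) (kill (suc i) b))
      where
      kill : ∀ j a → ⟦ n · u ⟧ j ⟨$⟩ʳ a ≡ a
      kill j a = ≡.trans (≡.cong (λ c → proj₁ c ⟨$⟩ʳ a) (·-pointwise n u j)) (exponent (u j) a)

    module _ .{{_ : NonZero n}} where
      open PartialFunction (Word C k)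

      input-domain : ∀ y → Domain (input y)
      input-domain y =
        (λ i → ⟦ y ⟧ (inject₁ i) ∘ₚ flip (⟦ y ⟧ (suc i))) ,
        (λ i → ∘-closed (proj₂ (y (inject₁ i))) (inv-closed (proj₂ (y (suc i))))) ,
        λ i a b → let ρ = ⟦ y ⟧ (suc i) in ⌊⌋-⇔ _ _
          (λ eq → ≡.trans (≡.cong (ρ ⟨$⟩ˡ_) eq) (Perm.inverseˡ ρ))
          (λ eq → ≡.trans (≡.sym (Perm.inverseʳ ρ)) (≡.cong (ρ ⟨$⟩ʳ_) eq))

      input-value : ∀ y → value (input y) ≡ ratio (⟦ y ⟧ zero) (⟦ y ⟧ (fromℕ k)) first first
      input-value y rewrite ratio-product k ⟦ y ⟧ first first
        with ratio (⟦ y ⟧ zero) (⟦ y ⟧ (fromℕ k)) first first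
      ... | true  = ≡.refl
      ... | false = ≡.refl

      -- The translation moves the last potential to σ^r and keeps the first at 1. An unchanged
      -- value would make σ^r fix `first`, so σ^r = 1 by regularity, against the order of σ.
      word-nonconstant : IsRegular C → ∀ Φ → Computes Φ (Word C k) → ∀ {r} → 0 < r → r < n → ∀ i₀ →
                         eval Φ (input (r · jump i₀ ∙ ε)) ≢ eval Φ (input ε)
      word-nonconstant regular Φ computes {r} 0<r r<n i₀ eq = minimal r 0<r r<n σʳ≈id
        where
        y : A
        y = r · jump i₀ ∙ ε
        at-last : ⟦ y ⟧ (fromℕ k) ⟨$⟩ʳ first ≡ (generator ^ₚ r) ⟨$⟩ʳ first
        at-last = ≡.trans (≡.cong (λ c → proj₁ c ⟨$⟩ʳ first)
            (≡.trans (·-pointwise r (jump i₀) (fromℕ k)) (≡.cong (r ℂ.·_) (jump-last i₀))))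
          (·-^ₚ r first)
        at-zero : ⟦ y ⟧ zero ⟨$⟩ʳ first ≡ first
        at-zero = go r
          where
          go : ∀ r → ⟦ r · jump i₀ ∙ ε ⟧ zero ⟨$⟩ʳ first ≡ first
          go zero    = ≡.refl
          go (suc r) = go r
        agree : ratio (⟦ y ⟧ zero) (⟦ y ⟧ (fromℕ k)) first first ≡ ratio {n} Perm.id Perm.id first first
        agree = ≡.trans (≡.sym (eval-input y)) (≡.trans eq (eval-input ε))
          where
          eval-input : ∀ y → eval Φ (input y) ≡ ratio (⟦ y ⟧ zero) (⟦ y ⟧ (fromℕ k)) first first
          eval-input y = ≡.trans (computes (input y) (input-domain y)) (input-value y)
        fixed : (generator ^ₚ r) ⟨$⟩ʳ first ≡ first
        fixed with ⟦ y ⟧ zero ⟨$⟩ʳ first ≟ᶠ ⟦ y ⟧ (fromℕ k) ⟨$⟩ʳ first | first {n} ≟ᶠ first | agree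
        ... | yes eq′ | _     | _ = ≡.trans (≡.sym at-last) (≡.trans (≡.sym eq′) at-zero)
        ... | no _    | no ¬r | _ = ⊥-elim (¬r ≡.refl)
        power∈C : ∀ r → C (generator ^ₚ r)
        power∈C zero    = id-closed
        power∈C (suc r) = ∘-closed generator∈G (power∈C r)
        σʳ≈id : (generator ^ₚ r) Perm.≈ Perm.id
        σʳ≈id = IsRegular.free regular first (power∈C r) fixed

      word-invariant : ∀ {Φ} → Invariant (WordGroup C k) Φ → ∀ u → Γ ∋ u → relabel (act u) Φ ≅ Φ
      word-invariant inv u (z , l) = inv (act u) (⟦ u ⟧ , (λ j → proj₂ (u j)) , z , l , λ _ _ _ → ≡.refl)

word-size : ∀ {p} e → Prime p → .{{_ : NonZero (p ^ suc e)}} →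
  (C : Pred (Permutation′ (p ^ suc e)) 0ℓ) → IsSubgroup C → IsCyclicOfOrder (p ^ suc e) C → IsRegular C →
  ∀ {k} → Fin k → ∀ {Φ} → Invariant (WordGroup C k) Φ → Computes Φ (Word C k) →
  ¬ ¬ (∃[ N ] Cost k (depth Φ) 1 N × (p ^ suc e) ^ N ≤ size Φ)
word-size {p} e p-prime C C-group C-cyclic C-regular {k} i₀ {Φ} inv computes =
  size-bound (Γ k) (λ {u} → torsion k u) {Φ} {jump k i₀} {ε}
    (λ {u} → word-invariant k inv u) (jump-local k i₀)
    (word-nonconstant k C-regular Φ computes 0<p^e p^e<p^[1+e] i₀)
  where
  open WordSymmetry C C-group C-cyclic
  open LowerBound p-prime e (𝔸 k) (symmetry k)
  open AbelianGroup (𝔸 k) using (ε)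
  1<p : 1 < p
  1<p = nonTrivial⇒n>1 p {{prime⇒nonTrivial p-prime}}
  0<p^e : 0 < p ^ e
  0<p^e = m^n>0 p {{prime⇒nonZero p-prime}} e
  p^e<p^[1+e] : p ^ e < p ^ suc e
  p^e<p^[1+e] = ^-monoʳ-< p 1<p (n<1+n e)

-- Real exponents

-- A negative exponent only requires s to be positive, so the bound on r is assumed for nonnegative
-- r alone.
^ℚ-from-≤ : ∀ q .{{_ : NonZero q}} N {s} → q ^ N ≤ s → ∀ r →
            (∀ {a f} → r ≡ mkℚᵘ (+ a) f → a ≤ N * suc f) → q ^ℚ r ≼ s
^ℚ-from-≤ q N {s} q^N≤s (mkℚᵘ (+ a) f) a≤Nf = begin
  q ^ a            ≤⟨ ^-monoʳ-≤ q (a≤Nf ≡.refl) ⟩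
  q ^ (N * suc f)  ≡⟨ ^-*-assoc q N (suc f) ⟨
  (q ^ N) ^ suc f  ≤⟨ ^-monoˡ-≤ (suc f) q^N≤s ⟩
  s ^ suc f        ∎
  where open ≤-Reasoning
^ℚ-from-≤ q N {s} q^N≤s (mkℚᵘ -[1+ a ] f) _ =
  *-mono-≤ (m^n>0 q (suc a)) (m^n>0 s {{>-nonZero (<-≤-trans (m^n>0 q N) q^N≤s)}} (suc f))

-- Decidability of the final inequality discharges the double negations of the search.
^ℚ-stable : ∀ q r s → ¬ ¬ (q ^ℚ r ≼ s) → q ^ℚ r ≼ s
^ℚ-stable q (mkℚᵘ (+ a) f)    s = decidable-stable (q ^ a ≤? s ^ suc f)
^ℚ-stable q (mkℚᵘ -[1+ a ] f) s = decidable-stable (1 ≤? q ^ suc a * s ^ suc f)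

log-bound : ∀ {k} N → k ≤ 2 ^ N → ∀ {a} f → log₂ k (mkℚᵘ (+ a) f) → a ≤ N * suc f
log-bound {k} N k≤2^N {a} f 2^a≤k^f = ≮⇒≥ λ Nf<a → <⇒≱ (^-monoʳ-< 2 (s≤s (s≤s z≤n)) Nf<a) (begin
  2 ^ a            ≤⟨ 2^a≤k^f ⟩
  k ^ suc f        ≤⟨ ^-monoˡ-≤ (suc f) k≤2^N ⟩
  (2 ^ N) ^ suc f  ≡⟨ ^-*-assoc 2 N (suc f) ⟩
  2 ^ (N * suc f)  ∎)
  where open ≤-Reasoning

root-bound : ∀ {k} d N → k * suc d ^ suc d ≤ (suc d + N) ^ suc d →
             ∀ {a} f → (suc d ·ℝ (root (suc d) k -1ℝ)) (mkℚᵘ (+ a) f) → a ≤ N * suc f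
root-bound {k} d N k≤ {a} f r∈ = +-cancelʳ-≤ (F * D) a (N * F) (≮⇒≥ λ NF+FD<a+FD →
  <⇒≱ (^-monoˡ-< D NF+FD<a+FD) (begin
    (a + F * D) ^ D        ≤⟨ membership numerator r∈ ⟩
    k * (F * D * 1) ^ D    ≡⟨ ≡.cong (λ g → k * g ^ D) (*-identityʳ (F * D)) ⟩
    k * (F * D) ^ D        ≡⟨ ≡.cong (k *_) (^-distrib-* F D D) ⟩
    k * (F ^ D * D ^ D)    ≡⟨ regroup k (F ^ D) (D ^ D) ⟩
    k * D ^ D * F ^ D      ≤⟨ *-monoˡ-≤ (F ^ D) k≤ ⟩
    (D + N) ^ D * F ^ D    ≡⟨ ^-distrib-* (D + N) F D ⟨
    ((D + N) * F) ^ D      ≡⟨ ≡.cong (_^ D) (expand D N F) ⟩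
    (N * F + F * D) ^ D    ∎))
  where
  open ≤-Reasoning
  D F : ℕ
  D = suc d
  F = suc f
  membership : ∀ {i b g} → i ≡ + b → root D k (mkℚᵘ i g) → b ^ D ≤ k * suc g ^ D
  membership ≡.refl b∈ = b∈
  numerator : (+ a ℤ.* + 1) ℤ.* + 1 ℤ.+ + 1 ℤ.* + (F * D) ≡ + (a + F * D)
  numerator = ≡.cong₂ ℤ._+_ (≡.trans (ℤ.*-identityʳ (+ a ℤ.* + 1)) (ℤ.*-identityʳ (+ a)))
    (ℤ.*-identityˡ (+ (F * D)))
  regroup : ∀ k P Q → k * (P * Q) ≡ k * Q * P
  regroup = solve-∀
  expand : ∀ D N F → (D + N) * F ≡ N * F + F * D
  expand = solve-∀

theorem1p4 : (q : ℕ) .{{_ : NonZero q}} → IsPrimePower q →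
    (C : Pred (Permutation′ q) 0ℓ) → IsSubgroup C → IsCyclicOfOrder q C → IsRegular C →
    (k d : ℕ) .{{_ : NonZero k}} .{{_ : NonZero d}} →
    (q ^ℝ log₂ k ≼min Sizes-AC (WordGroup C k) (Word C k)) ×
    (q ^ℝ (d ·ℝ (root d k -1ℝ)) ≼min Sizes-ACd d (WordGroup C k) (Word C k))
-- The exponent of the prime is positive, hence `suc e`. As k ≥ 1, there is a block `zero` at which
-- to place the jump.
theorem1p4 q (p , suc e , p-prime , _ , ≡.refl) C C-group C-cyclic C-regular k@(suc _) (suc d) =
  (λ { _ (Φ , inv , computes , ≡.refl) r r∈ → ^ℚ-stable q r (size Φ) λ ∉ →
    word-size e p-prime C C-group C-cyclic C-regular zero inv computes λ (N , cost , q^N≤size) →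
      ∉ (^ℚ-from-≤ q N q^N≤size r λ { ≡.refl →
        log-bound N (≤-trans (cost-log cost) (≤-reflexive (*-identityˡ (2 ^ N)))) _ r∈ }) }) ,
  (λ { _ (Φ , inv , depth≤ , computes , ≡.refl) r r∈ → ^ℚ-stable q r (size Φ) λ ∉ →
    word-size e p-prime C C-group C-cyclic C-regular zero inv computes λ (N , cost , q^N≤size) →
      ∉ (^ℚ-from-≤ q N q^N≤size r λ { ≡.refl →
        root-bound d N (≤-trans (cost-root (cost-mono depth≤ cost)) (≤-reflexive (*-identityˡ _))) _ r∈ }) })
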